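{- Let $\mathbf M=(m_1,\dots,m_r)$ be a Motzkin path and suppose the seed $(\mathbf x,B)$ is obtained from $(\mathbf x_0,B_0)$ by a finite sequence of $Q$-system mutations, each intermediate cluster being of the form $\mathbf x_{\mathbf M'}$ for a Motzkin path $\mathbf M'$, and the final cluster being $\mathbf x_{\mathbf M}$. Then $B=B(\mathbf M)$ where, for $1\le i,j\le r$ and with $C$ the Cartan matrix of $A_r$, $$B(\mathbf M)_{i,j}=(-1)^{\lfloor\frac{m_j+1}{2}\rfloor}\Bigl((-1)^{\lfloor\frac{m_i}{2}\rfloor}-(-1)^{\lfloor\frac{m_j}{2}\rfloor}\Bigr)\delta_{|i-j|,1},$$ $$B(\mathbf M)_{i,j+r}=(-1)^{\lfloor\frac{m_i+1}{2}\rfloor+\lfloor\frac{m_j}{2}\rfloor+1}C_{i,j},\qquad B(\mathbf M)_{i+r,j}=(-1)^{\lfloor\frac{m_i}{2}\rfloor+\lfloor\frac{m_j+1}{2}\rfloor}C_{i,j},$$ $$B(\mathbf M)_{i+r,j+r}=(-1)^{\lfloor\frac{m_i}{2}\rfloor}\Bigl((-1)^{\lfloor\frac{m_j+1}{2}\rfloor}-(-1)^{\lfloor\frac{m_i+1}{2}\rfloor}\Bigr)\delta_{|i-j|,1}.$$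
   Context: Fix $r\ge1$, $I_r=\{1,\dots,r\}$, and let $(R_{\alpha,n})_{0\le\alpha\le r+1,n\in\mathbb Z}$ be the $A_r$ $Q$-system: $R_{1,0},\dots,R_{r,0},R_{1,1},\dots,R_{r,1}$ are algebraically independent indeterminates, $R_{0,n}=R_{r+1,n}=1$, and $R_{\alpha,n+1}R_{\alpha,n-1}=R_{\alpha,n}^2+R_{\alpha+1,n}R_{\alpha-1,n}$. $C$ is the $r\times r$ Cartan matrix of $A_r$ ($C_{ii}=2$, $C_{ij}=-1$ if $|i-j|=1$, $0$ otherwise). Cluster algebra conventions (rank $2r$, no coefficients): a seed is a pair $(\mathbf x,B)$ with $\mathbf x=(x_1,\dots,x_{2r})$ and $B$ a skew-symmetric integer $2r\times 2r$ matrix. The mutation $\mu_k$ replaces $x_k$ by $x_k'=x_k^{ -1}\bigl(\prod_i x_i^{[B_{ik}]_+}+\prod_i x_i^{[-B_{ik}]_+}\bigr)$ ($[n]_+=\max(n,0)$), leaves other $x_j$ unchanged, and replaces $B$ by $B'$ with $B'_{ij}=-B_{ij}$ if $i=k$ or $j=k$, and $B'_{ij}=B_{ij}+\mathrm{sign}(B_{ik})[B_{ik}B_{kj}]_+$ otherwise. The initial seed is $\mathbf x_0=(R_{1,0},\dots,R_{r,0},R_{1,1},\dots,R_{r,1})$, $B_0=\begin{pmatrix}0&-C\\ C&0\end{pmatrix}$ (so $(B_0)_{i,j+r}=-C_{ij}$, $(B_0)_{i+r,j}=C_{ij}$). A Motzkin path is $\mathbf M=(m_1,\dots,m_r)\in\mathbb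 Z^r$ with $|m_{\alpha+1}-m_\alpha|\le1$ for $1\le\alpha<r$. Its cluster $\mathbf x_{\mathbf M}=(x_1,\dots,x_{2r})$ is defined by: for $\alpha\in I_r$, $x_\alpha$ is whichever of $R_{\alpha,m_\alpha},R_{\alpha,m_\alpha+1}$ has even second index and $x_{\alpha+r}$ is the one with odd second index (so $\mathbf x_{(0,\dots,0)}=\mathbf x_0$). A $Q$-system mutation is a mutation $\mu_k$ ($k=\alpha$ or $k=\alpha+r$) replacing a cluster entry $R_{\alpha,n\mp1}$ by $R_{\alpha,n\pm1}$, i.e. one that changes one $m_\alpha$ by $\pm1$. -}

module Defs where

open import Level using (Level; _⊔_)
open import Algebra.Apartness.Bundles using (HeytingField; HeytingCommutativeRing)
open import Algebra.Bundles using (CommutativeRing; Semiring)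
open import Algebra.Definitions using (Invertible)
import Algebra.Apartness.Properties.HeytingCommutativeRing as HeytingProperties
import Algebra.Definitions.RawSemiring as RawSemiringDefinitions
open import Data.Bool.Base using (true; false; if_then_else_; _∨_)
open import Data.Bool.Properties using (∨-comm)
open import Data.Fin.Base using (Fin; zero; suc; toℕ; fromℕ; inject₁; splitAt; _↑ˡ_; _↑ʳ_)
open import Data.Fin.Properties using (_≟_)
open import Data.Integer.Base using (ℤ; +_; -[1+_]; +[1+_]; 0ℤ; 1ℤ; -1ℤ; -_; ∣_∣; _/ℕ_; _%ℕ_)
import Data.Integer.Base as ℤ
import Data.Integer.Properties as ℤₚ
open import Data.List.Base using (List; []; _∷_; map)
open import Data.List.Relation.Unary.All using (All)
open import Data.List.Relation.Unary.Unique.Propositional using (Unique)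
open import Data.Nat.Base using (ℕ; zero; suc; _≤_; _≡ᵇ_; ∣_-_∣)
import Data.Nat.Base as ℕ
import Data.Nat.Properties as ℕₚ
open import Data.Product.Base using (_×_; _,_; proj₁; proj₂; ∃-syntax)
open import Data.Sum.Base using (_⊎_; inj₁; inj₂)
open import Data.Vec.Base using (Vec; lookup)
open import Data.Vec.Functional using (Vector; _++_)
open import Relation.Binary.PropositionalEquality.Core using (_≡_; refl; sym; trans; cong)
open import Relation.Nullary.Decidable.Core using (does)

Matrix : ℕ → Set
Matrix n = Fin n → Fin n → ℤ

SkewSymmetric : ∀ {n} → Matrix n → Set
SkewSymmetric B = ∀ i j → B j i ≡ - B i j

-- Index i (resp. i + r) of the 2r × 2r matrix is  i ↑ˡ r  (resp.  r ↑ʳ i).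
blocks : ∀ {r} → Matrix r → Matrix r → Matrix r → Matrix r → Matrix (r ℕ.+ r)
blocks {r} P Q S T a b = entry (splitAt r a) (splitAt r b)
  where
  entry : Fin r ⊎ Fin r → Fin r ⊎ Fin r → ℤ
  entry (inj₁ i) (inj₁ j) = P i j
  entry (inj₁ i) (inj₂ j) = Q i j
  entry (inj₂ i) (inj₁ j) = S i j
  entry (inj₂ i) (inj₂ j) = T i j

[_]₊ : ℤ → ℤ
[ n ]₊ = n ℤ.⊔ 0ℤ

sgn : ℤ → ℤ
sgn (+ zero)  = 0ℤ
sgn +[1+ _ ]  = 1ℤ
sgn -[1+ _ ]  = -1ℤ

mutateMatrix : ∀ {n} → Fin n → Matrix n → Matrix n
mutateMatrix k B i j =
  if does (i ≟ k) ∨ does (j ≟ k)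
  then - B i j
  else B i j ℤ.+ sgn (B i k) ℤ.* [ B i k ℤ.* B k j ]₊

private
  swap-term : ∀ a b → sgn (- b) ℤ.* [ - b ℤ.* - a ]₊ ≡ - (sgn a ℤ.* [ a ℤ.* b ]₊)
  swap-term (+ zero)  (+ zero)  = refl
  swap-term (+ zero)  +[1+ n ]  rewrite ℕₚ.*-zeroʳ n = refl
  swap-term (+ zero)  -[1+ n ]  rewrite ℕₚ.*-zeroʳ n = refl
  swap-term +[1+ m ]  (+ zero)  rewrite ℕₚ.*-zeroʳ m = refl
  swap-term -[1+ m ]  (+ zero)  rewrite ℕₚ.*-zeroʳ m = refl
  swap-term +[1+ m ]  +[1+ n ]
    rewrite ℕₚ.suc-injective (ℕₚ.*-comm (suc m) (suc n)) = refl
  swap-term +[1+ m ]  -[1+ n ]  = refl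
  swap-term -[1+ m ]  +[1+ n ]  = refl
  swap-term -[1+ m ]  -[1+ n ]
    rewrite ℕₚ.suc-injective (ℕₚ.*-comm (suc m) (suc n)) = refl

mutateMatrix-skew : ∀ {n} (k : Fin n) (B : Matrix n) →
                    SkewSymmetric B → SkewSymmetric (mutateMatrix k B)
mutateMatrix-skew k B skew i j
  rewrite ∨-comm (does (j ≟ k)) (does (i ≟ k))
  with does (i ≟ k) ∨ does (j ≟ k)
... | true  = cong -_ (skew i j)
... | false
  rewrite skew i j | skew k j | skew i k
        | swap-term (B i k) (B k j)
  = sym (ℤₚ.neg-distrib-+ (B i j) _)

cartanEntry : ℕ → ℤ
cartanEntry 0 = + 2
cartanEntry 1 = -1ℤ
cartanEntry _ = 0ℤ

cartan : ∀ {r} → Matrix r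
cartan i j = cartanEntry ∣ toℕ i - toℕ j ∣

B₀ : ∀ r → Matrix (r ℕ.+ r)
B₀ r = blocks {r} (λ _ _ → 0ℤ) (λ i j → - cartan i j) cartan (λ _ _ → 0ℤ)

B₀-skew : ∀ r → SkewSymmetric (B₀ r)
B₀-skew r a b with splitAt r a | splitAt r b
... | inj₁ i | inj₁ j = refl
... | inj₁ i | inj₂ j = trans (cong cartanEntry (ℕₚ.∣-∣-comm (toℕ j) (toℕ i)))
                              (sym (ℤₚ.neg-involutive (cartan i j)))
... | inj₂ i | inj₁ j = cong (λ d → - cartanEntry d) (ℕₚ.∣-∣-comm (toℕ j) (toℕ i))
... | inj₂ i | inj₂ j = refl

IsMotzkin : ∀ {r} → Vector ℤ r → Set
IsMotzkin {r} m = (α β : Fin r) → toℕ β ≡ suc (toℕ α) → ∣ m β ℤ.- m α ∣ ≤ 1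

-- (-1)^e for an integer exponent e, which has the parity of ∣ e ∣.
[-1]^_ : ℤ → ℤ
[-1]^ e = -1ℤ ℤ.^ ∣ e ∣

-- _/ℕ_ has a non-negative remainder, hence rounds towards -∞.
⌊_/2⌋ : ℤ → ℤ
⌊ m /2⌋ = m /ℕ 2

δ : ℕ → ℕ → ℤ
δ m n = if m ≡ᵇ n then 1ℤ else 0ℤ

Bᴹ : ∀ {r} → Vector ℤ r → Matrix (r ℕ.+ r)
Bᴹ {r} m = blocks {r}
  (λ i j → [-1]^ ⌊ m j ℤ.+ 1ℤ /2⌋
             ℤ.* ([-1]^ ⌊ m i /2⌋ ℤ.- [-1]^ ⌊ m j /2⌋)
             ℤ.* δ ∣ toℕ i - toℕ j ∣ 1)
  (λ i j → [-1]^ (⌊ m i ℤ.+ 1ℤ /2⌋ ℤ.+ ⌊ m j /2⌋ ℤ.+ 1ℤ) ℤ.* cartan i j)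
  (λ i j → [-1]^ (⌊ m i /2⌋ ℤ.+ ⌊ m j ℤ.+ 1ℤ /2⌋) ℤ.* cartan i j)
  (λ i j → [-1]^ ⌊ m i /2⌋
             ℤ.* ([-1]^ ⌊ m j ℤ.+ 1ℤ /2⌋ ℤ.- [-1]^ ⌊ m i ℤ.+ 1ℤ /2⌋)
             ℤ.* δ ∣ toℕ i - toℕ j ∣ 1)

evenOf oddOf : ℤ → ℤ
evenOf m = if m %ℕ 2 ≡ᵇ 0 then m else m ℤ.+ 1ℤ
oddOf  m = if m %ℕ 2 ≡ᵇ 0 then m ℤ.+ 1ℤ else m

-- A label α ∈ {1,…,r} is represented by  i : Fin r  with α = 1 + toℕ i.
-- As elements of {0,…,r+1}, the labels α - 1, α, α + 1 are then:
below here above : ∀ {r} → Fin r → Fin (suc (suc r))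
below i = inject₁ (inject₁ i)
here  i = suc (inject₁ i)
above i = suc (suc i)

module _ {c ℓ₁ ℓ₂ : Level} (F : HeytingField c ℓ₁ ℓ₂) where

  open HeytingField F using (heytingCommutativeRing)
  open HeytingCommutativeRing heytingCommutativeRing
    using (Carrier; _≈_; _#_; _+_; _*_; 0#; 1#; commutativeRing; #⇒invertible)
    renaming (-_ to neg)
  open CommutativeRing commutativeRing using (semiring; *-congˡ; *-congʳ)
    renaming (sym to ≈-sym; trans to ≈-trans)
  open HeytingProperties heytingCommutativeRing using (x-0≈x)
  open RawSemiringDefinitions (Semiring.rawSemiring semiring)
    using (_^_; product) renaming (_×_ to _·_)

  #0⇒invertible : ∀ {x} → x # 0# → Invertible _≈_ 1# _*_ x
  #0⇒invertible {x} x#0 with y , yx≈1 , xy≈1 ← #⇒invertible x#0 =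
    y , ≈-trans (*-congˡ (≈-sym (x-0≈x x))) yx≈1
      , ≈-trans (*-congʳ (≈-sym (x-0≈x x))) xy≈1

  inverse : ∀ {x} → x # 0# → Carrier
  inverse x#0 = proj₁ (#0⇒invertible x#0)

  fromℤ : ℤ → Carrier
  fromℤ (+ n)    = n · 1#
  fromℤ -[1+ n ] = neg (suc n · 1#)

  -- Polynomials as lists of (coefficient, exponent vector).
  evalPoly : ∀ {n} → List (ℤ × Vec ℕ n) → Vector Carrier n → Carrier
  evalPoly []            x = 0#
  evalPoly ((a , e) ∷ p) x = fromℤ a * product (λ i → x i ^ lookup e i) + evalPoly p x

  -- Integer coefficients suffice for independence over ℚ (clear
  -- denominators); constant polynomials force characteristic 0.
  AlgebraicallyIndependent : ∀ {n} → Vector Carrier n → Set ℓ₁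
  AlgebraicallyIndependent {n} x =
    (p : List (ℤ × Vec ℕ n)) → Unique (map proj₂ p) →
    evalPoly p x ≈ 0# → All (λ t → proj₁ t ≡ 0ℤ) p

  record Seed (n : ℕ) : Set c where
    field
      cluster : Vector Carrier n
      matrix  : Matrix n
      skew    : SkewSymmetric matrix

  open Seed

  mutateCluster : ∀ {n} (k : Fin n) (x : Vector Carrier n) → Matrix n →
                  x k # 0# → Vector Carrier n
  mutateCluster k x B xₖ#0 j =
    if does (j ≟ k)
    then inverse xₖ#0 * ( product (λ i → x i ^ ∣ [ B i k ]₊ ∣)
                        + product (λ i → x i ^ ∣ [ - B i k ]₊ ∣))
    else x j

  mutate : ∀ {n} (k : Fin n) (s : Seed n) → cluster s k # 0# → Seed n
  mutate k s xₖ#0 = record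
    { cluster = mutateCluster k (cluster s) (matrix s) xₖ#0
    ; matrix  = mutateMatrix k (matrix s)
    ; skew    = mutateMatrix-skew k (matrix s) (skew s)
    }

  record QSystem (r : ℕ) : Set (c ⊔ ℓ₁) where
    field
      R : Fin (suc (suc r)) → ℤ → Carrier

    x₀ : Vector Carrier (r ℕ.+ r)
    x₀ = (λ (α : Fin r) → R (here α) 0ℤ) ++ (λ (α : Fin r) → R (here α) 1ℤ)

    field
      R-first     : ∀ n → R zero n ≈ 1#
      R-last      : ∀ n → R (fromℕ (suc r)) n ≈ 1#
      R-relation  : ∀ (α : Fin r) n →
                    R (here α) (n ℤ.+ 1ℤ) * R (here α) (n ℤ.- 1ℤ)
                      ≈ R (here α) n ^ 2 + R (above α) n * R (below α) n
      independent : AlgebraicallyIndependent x₀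

  module _ {r : ℕ} (Q : QSystem r) where

    open QSystem Q

    initialSeed : Seed (r ℕ.+ r)
    initialSeed = record { cluster = x₀ ; matrix = B₀ r ; skew = B₀-skew r }

    xᴹ : Vector ℤ r → Vector Carrier (r ℕ.+ r)
    xᴹ m = (λ α → R (here α) (evenOf (m α))) ++ (λ α → R (here α) (oddOf (m α)))

    HasCluster : Seed (r ℕ.+ r) → Vector ℤ r → Set ℓ₁
    HasCluster s m = ∀ i → cluster s i ≈ xᴹ m i

    IsQMutation : (k : Fin (r ℕ.+ r)) (s s′ : Seed (r ℕ.+ r)) → Set ℓ₁
    IsQMutation k s s′ =
      ∃[ α ] ∃[ n ]
        (k ≡ α ↑ˡ r ⊎ k ≡ r ↑ʳ α) ×
        (  (cluster s k ≈ R (here α) (n ℤ.- 1ℤ) × cluster s′ k ≈ R (here α) (n ℤ.+ 1ℤ))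
         ⊎ (cluster s k ≈ R (here α) (n ℤ.+ 1ℤ) × cluster s′ k ≈ R (here α) (n ℤ.- 1ℤ)))

    data Reachable : Seed (r ℕ.+ r) → Set (c ⊔ ℓ₁ ⊔ ℓ₂) where
      start : Reachable initialSeed
      step  : ∀ {s} → Reachable s →
              (k : Fin (r ℕ.+ r)) (xₖ#0 : cluster s k # 0#) →
              IsQMutation k s (mutate k s xₖ#0) →
              (m : Vector ℤ r) → IsMotzkin m →
              HasCluster (mutate k s xₖ#0) m →
              Reachable (mutate k s xₖ#0)

module Submission where

-- Specialising every initial variable R_{α,0}, R_{α,1} to 1 turns the
-- Q-system into a recursion on positive rationals with
-- R_{α,n+1} R_{α,n-1} > R_{α,n}², so its values strictly increase for n ≥ 1,
-- and symmetrically for n ≤ 0.  By algebraic independence an equality in the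
-- field survives the specialisation, hence R_{α,p} = R_{α,q} forces p = q or
-- p + q = 1, which is impossible for p, q of equal parity: a cluster determines
-- its Motzkin path.
--
-- The matrix B(M) depends only on the signs a_i = (-1)^⌊m_i/2⌋ and
-- b_i = (-1)^⌊(m_i+1)/2⌋, which the odd and even members of the cluster
-- determine.  A mutation at the even (odd) variable of α flips b_α (a_α) only.
-- As both the old and the new path are Motzkin, the neighbours of α have the
-- same a (b) as α, so the pivot has no arrow inside its own half and the
-- mutation rule reduces to a check on the neighbours of α.

open import Defs
open import Level using (Level)
open import Algebra.Apartness.Bundles using (HeytingField; HeytingCommutativeRing)
open import Algebra.Bundles using (AbelianGroup; CommutativeRing)
import Algebra.Properties.CommutativeMonoid.Sum as Sum
import Algebra.Properties.CommutativeSemigroup as CommutativeSemigroupProperties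
import Algebra.Properties.Group as GroupProperties
import Algebra.Properties.Ring as RingProperties
import Algebra.Properties.Semiring.Exp as Exp
open import Data.Bool.Properties using (∨-zeroʳ)
open import Data.Fin.Base using (Fin; zero; suc; toℕ; fromℕ; splitAt; _↑ˡ_; _↑ʳ_)
import Data.Fin.Properties as Finₚ
open import Data.Fin.Relation.Unary.Top using (view; ‵fromℕ; ‵inject₁; view-inject₁)
open import Data.Integer.Base using (ℤ; +_; -[1+_]; +[1+_]; 0ℤ; 1ℤ; -1ℤ; _%ℕ_)
import Data.Integer.Base as ℤ
open import Data.Integer.DivMod using (a≡a%ℕn+[a/ℕn]*n; n%ℕd<d)
import Data.Integer.Properties as ℤₚ
open import Data.Integer.Solver using () renaming (module +-*-Solver to ℤ-Solver)
open import Data.List.Base using (List; []; _∷_; _++_; map; length; cartesianProductWith)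
open import Data.List.Properties using (length-++; length-map)
open import Data.List.Relation.Unary.All using (All; []; _∷_)
open import Data.List.Relation.Unary.AllPairs using ([]; _∷_)
open import Data.List.Relation.Unary.Unique.Propositional using (Unique)
open import Data.Nat.Base using (ℕ; zero; suc; _+_; _*_; _≤_; _<_; s≤s; z≤n; ∣_-_∣)
import Data.Nat.Base as ℕ
import Data.Nat.Properties as ℕₚ
open import Data.Nat.Solver using (module +-*-Solver)
open import Data.Product.Base using (_×_; _,_; proj₁; proj₂; ∃-syntax)
open import Data.Sign.Base using (Sign; opposite) renaming (_*_ to _*ₛ_; + to pos; - to neg)
import Data.Sign.Properties as Signₚ
open import Data.Sum.Base using (_⊎_; inj₁; inj₂; swap)
open import Data.Vec.Base using (Vec; []; _∷_; lookup; zipWith; replicate)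
open import Data.Vec.Functional using (Vector)
import Data.Vec.Functional.Properties as Vectorₚ
import Data.Vec.Properties as Vecₚ
open import Function.Base using (_∘_)
open import Relation.Binary.Definitions using (tri<; tri≈; tri>)
open import Relation.Binary.PropositionalEquality
  using (_≡_; _≢_; refl; sym; trans; cong; cong₂; subst; subst₂; module ≡-Reasoning)
open import Relation.Nullary.Decidable using (yes; no; does; dec-true; dec-false)
open import Relation.Nullary.Negation.Core using (¬_; contradiction)

open GroupProperties (AbelianGroup.group ℤₚ.+-0-abelianGroup) using (∙-cancelʳ)

-- A path is tied to a seed only through field elements compared up to `≈`, so the variables R_{α,n}
-- have to be told apart before anything can be said about paths. Setting the initial variables to 1
-- is not a map on the field. It is replaced by a relation, `HasValue`: an element is tied to the
-- fraction p/q by two polynomials with natural coefficients, having p and q monomials. Products,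
-- sums and quotients of elements are followed on these polynomials without a single inverse in the
-- field. No minus sign ever occurs, so the value of a polynomial at (1,...,1) is the number of its
-- monomials and the denominators stay positive there. The specialised initial data are symmetric
-- under n ↦ 1 - n, so this cannot separate R_{α,n} from R_{α,1-n}; but these two indices differ in
-- parity, and a cluster keeps even and odd indices in separate halves.

length-cartesianProductWith : ∀ {a b c} {A : Set a} {B : Set b} {C : Set c}
  (f : A → B → C) xs ys →
  length (cartesianProductWith f xs ys) ≡ length xs ℕ.* length ys
length-cartesianProductWith f []       ys = refl
length-cartesianProductWith f (x ∷ xs) ys =
  trans (length-++ (map (f x) ys))
    (cong₂ ℕ._+_ (length-map (f x) ys) (length-cartesianProductWith f xs ys))

-- Integer polynomials and their values at (1,...,1)

-- The value at (1,...,1): every monomial becomes 1, so the exponents do not matter.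
coefficientSum : ∀ {a} {A : Set a} → List (ℤ × A) → ℤ
coefficientSum []            = 0ℤ
coefficientSum ((a , _) ∷ p) = a ℤ.+ coefficientSum p

coefficientSum-zero : ∀ {a} {A : Set a} {p : List (ℤ × A)} →
                      All (λ t → proj₁ t ≡ 0ℤ) p → coefficientSum p ≡ 0ℤ
coefficientSum-zero []         = refl
coefficientSum-zero (refl ∷ z) = trans (ℤₚ.+-identityˡ _) (coefficientSum-zero z)

module _ {n : ℕ} where

  addTerm : ℤ → Vec ℕ n → List (ℤ × Vec ℕ n) → List (ℤ × Vec ℕ n)
  addTerm a e [] = (a , e) ∷ []
  addTerm a e ((b , f) ∷ p) with Vecₚ.≡-dec ℕₚ._≟_ e f
  ... | yes _ = (a ℤ.+ b , f) ∷ p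
  ... | no  _ = (b , f) ∷ addTerm a e p

  -- `AlgebraicallyIndependent` speaks of polynomials with pairwise distinct exponent vectors, so
  -- like terms have to be merged before it applies. Terms with coefficient 0 may remain.
  collect : List (ℤ × Vec ℕ n) → List (ℤ × Vec ℕ n)
  collect []            = []
  collect ((a , e) ∷ p) = addTerm a e (collect p)

  addTerm-fresh : ∀ {g} a e p → g ≢ e → All (g ≢_) (map proj₂ p) →
                  All (g ≢_) (map proj₂ (addTerm a e p))
  addTerm-fresh a e []            g≢e []        = g≢e ∷ []
  addTerm-fresh a e ((b , f) ∷ p) g≢e (g≢f ∷ h) with Vecₚ.≡-dec ℕₚ._≟_ e f
  ... | yes _ = g≢f ∷ h
  ... | no  _ = g≢f ∷ addTerm-fresh a e p g≢e h

  addTerm-unique : ∀ a e p → Unique (map proj₂ p) → Unique (map proj₂ (addTerm a e p))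
  addTerm-unique a e []            []      = [] ∷ []
  addTerm-unique a e ((b , f) ∷ p) (h ∷ u) with Vecₚ.≡-dec ℕₚ._≟_ e f
  ... | yes _   = h ∷ u
  ... | no  e≢f = addTerm-fresh a e p (e≢f ∘ sym) h ∷ addTerm-unique a e p u

  collect-unique : ∀ p → Unique (map proj₂ (collect p))
  collect-unique []            = []
  collect-unique ((a , e) ∷ p) = addTerm-unique a e (collect p) (collect-unique p)

  coefficientSum-addTerm : ∀ a e (p : List (ℤ × Vec ℕ n)) →
                           coefficientSum (addTerm a e p) ≡ a ℤ.+ coefficientSum p
  coefficientSum-addTerm a e [] = refl
  coefficientSum-addTerm a e ((b , f) ∷ p) with Vecₚ.≡-dec ℕₚ._≟_ e f
  ... | yes _ = ℤₚ.+-assoc a b _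
  ... | no  _ = trans (cong (ℤ._+_ b) (coefficientSum-addTerm a e p))
                  (x∙yz≈y∙xz b a (coefficientSum p))
    where open CommutativeSemigroupProperties ℤₚ.+-commutativeSemigroup

  coefficientSum-collect : ∀ p → coefficientSum (collect p) ≡ coefficientSum p
  coefficientSum-collect []            = refl
  coefficientSum-collect ((a , e) ∷ p) =
    trans (coefficientSum-addTerm a e (collect p))
          (cong (ℤ._+_ a) (coefficientSum-collect p))

  -- A polynomial with natural coefficients is encoded as the list of its
  -- monomials, repeated as often as they occur.
  difference : List (Vec ℕ n) → List (Vec ℕ n) → List (ℤ × Vec ℕ n)
  difference []      []      = []
  difference []      (e ∷ Q) = (-1ℤ , e) ∷ difference [] Q
  difference (e ∷ P) Q       = (1ℤ , e) ∷ difference P Q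

  coefficientSum-difference : ∀ P Q →
    coefficientSum (difference P Q) ℤ.+ (+ length Q) ≡ + length P
  coefficientSum-difference []      []      = refl
  coefficientSum-difference []      (e ∷ Q) = begin
    -1ℤ ℤ.+ D ℤ.+ (+ suc (length Q))  ≡⟨ cong (ℤ._+ (+ suc (length Q))) (ℤₚ.+-comm -1ℤ D) ⟩
    D ℤ.+ -1ℤ ℤ.+ (+ suc (length Q))  ≡⟨ ℤₚ.+-assoc D -1ℤ (+ suc (length Q)) ⟩
    D ℤ.+ (+ length Q)                ≡⟨ coefficientSum-difference [] Q ⟩
    0ℤ                                ∎
    where open ≡-Reasoning
          D = coefficientSum (difference [] Q)
  coefficientSum-difference (e ∷ P) Q =
    trans (ℤₚ.+-assoc 1ℤ (coefficientSum (difference P Q)) _)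
          (cong (ℤ._+_ 1ℤ) (coefficientSum-difference P Q))

unitVec : ∀ {n} → Fin n → Vec ℕ n
unitVec {suc n} zero    = 1 ∷ replicate n 0
unitVec         (suc i) = 0 ∷ unitVec i

-- Evaluation of polynomials in the field

module Evaluation {c ℓ₁ ℓ₂ : Level} (F : HeytingField c ℓ₁ ℓ₂) where

  open CommutativeRing
    (HeytingCommutativeRing.commutativeRing (HeytingField.heytingCommutativeRing F)) public
    using ( Carrier; _≈_; -_; 0#; 1#; semiring; ring; setoid
          ; +-cong; +-congˡ; +-congʳ; +-assoc; +-identityˡ; +-identityʳ
          ; *-cong; *-congˡ; *-congʳ; *-assoc; *-comm; *-identityˡ; *-identityʳ
          ; zeroˡ; distribˡ; distribʳ; -‿cong; -‿inverseˡ; -‿inverseʳ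
          ; +-commutativeSemigroup; *-commutativeSemigroup; *-commutativeMonoid )
    renaming ( _+_ to infixl 6 _⊕_; _*_ to infixl 7 _⊛_
             ; refl to ≈-refl; sym to ≈-sym; trans to ≈-trans; reflexive to ≈-reflexive )
  open Exp semiring using (_^_; ^-homo-*)
  open RingProperties ring using (-‿+-comm; -1*x≈-x)
  open Sum *-commutativeMonoid using ()
    renaming (sum to product; sum-cong-≋ to product-cong; ∑-distrib-+ to product-distrib-*
             ; sum-replicate-zero to product-1)
  open import Relation.Binary.Reasoning.Setoid setoid
  private module +S = CommutativeSemigroupProperties +-commutativeSemigroup

  fromℤ-suc : ∀ a → fromℤ F (1ℤ ℤ.+ a) ≈ 1# ⊕ fromℤ F a
  fromℤ-suc (+ n) = ≈-refl
  fromℤ-suc -[1+ zero ] = begin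
    0#                ≈⟨ -‿inverseʳ (1# ⊕ 0#) ⟨
    1# ⊕ 0# ⊕ - (1# ⊕ 0#)  ≈⟨ +-congʳ (+-identityʳ 1#) ⟩
    1# ⊕ - (1# ⊕ 0#)  ∎
  fromℤ-suc -[1+ suc n ] = begin
    - u                ≈⟨ +-identityˡ (- u) ⟨
    0# ⊕ - u           ≈⟨ +-congʳ (-‿inverseʳ 1#) ⟨
    1# ⊕ - 1# ⊕ - u    ≈⟨ +-assoc 1# (- 1#) (- u) ⟩
    1# ⊕ (- 1# ⊕ - u)  ≈⟨ +-congˡ (-‿+-comm 1# u) ⟩
    1# ⊕ - (1# ⊕ u)    ∎
    where u = fromℤ F (+ suc n)

  fromℤ-pred : ∀ a → fromℤ F (-1ℤ ℤ.+ a) ≈ - 1# ⊕ fromℤ F a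
  fromℤ-pred a = begin
    v                  ≈⟨ +-identityˡ v ⟨
    0# ⊕ v             ≈⟨ +-congʳ (-‿inverseˡ 1#) ⟨
    - 1# ⊕ 1# ⊕ v      ≈⟨ +-assoc (- 1#) 1# v ⟩
    - 1# ⊕ (1# ⊕ v)    ≈⟨ +-congˡ (fromℤ-suc (-1ℤ ℤ.+ a)) ⟨
    - 1# ⊕ fromℤ F (1ℤ ℤ.+ (-1ℤ ℤ.+ a))  ≈⟨ +-congˡ (≈-reflexive (cong (fromℤ F) suc-pred)) ⟩
    - 1# ⊕ fromℤ F a   ∎
    where
    v = fromℤ F (-1ℤ ℤ.+ a)
    suc-pred : 1ℤ ℤ.+ (-1ℤ ℤ.+ a) ≡ a
    suc-pred = trans (sym (ℤₚ.+-assoc 1ℤ -1ℤ a)) (ℤₚ.+-identityˡ a)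

  fromℤ-neg1 : fromℤ F -1ℤ ≈ - 1#
  fromℤ-neg1 = -‿cong (+-identityʳ 1#)

  -- Merging like terms adds their coefficients, so additivity is what keeps the value of a
  -- polynomial unchanged under `collect`.
  fromℤ-+ : ∀ a b → fromℤ F (a ℤ.+ b) ≈ fromℤ F a ⊕ fromℤ F b
  fromℤ-+ (+ zero) b = begin
    fromℤ F (0ℤ ℤ.+ b)  ≡⟨ cong (fromℤ F) (ℤₚ.+-identityˡ b) ⟩
    fromℤ F b           ≈⟨ +-identityˡ (fromℤ F b) ⟨
    0# ⊕ fromℤ F b      ∎
  fromℤ-+ (+ suc n) b = begin
    fromℤ F (1ℤ ℤ.+ + n ℤ.+ b)          ≡⟨ cong (fromℤ F) (ℤₚ.+-assoc 1ℤ (+ n) b) ⟩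
    fromℤ F (1ℤ ℤ.+ (+ n ℤ.+ b))        ≈⟨ fromℤ-suc (+ n ℤ.+ b) ⟩
    1# ⊕ fromℤ F (+ n ℤ.+ b)            ≈⟨ +-congˡ (fromℤ-+ (+ n) b) ⟩
    1# ⊕ (fromℤ F (+ n) ⊕ fromℤ F b)    ≈⟨ +-assoc 1# _ _ ⟨
    fromℤ F (+ suc n) ⊕ fromℤ F b       ∎
  fromℤ-+ -[1+ zero ] b = begin
    fromℤ F (-1ℤ ℤ.+ b)       ≈⟨ fromℤ-pred b ⟩
    - 1# ⊕ fromℤ F b          ≈⟨ +-congʳ fromℤ-neg1 ⟨
    fromℤ F -1ℤ ⊕ fromℤ F b   ∎
  fromℤ-+ -[1+ suc n ] b = begin
    fromℤ F (-1ℤ ℤ.+ -[1+ n ] ℤ.+ b)      ≡⟨ cong (fromℤ F) (ℤₚ.+-assoc -1ℤ -[1+ n ] b) ⟩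
    fromℤ F (-1ℤ ℤ.+ (-[1+ n ] ℤ.+ b))    ≈⟨ fromℤ-pred (-[1+ n ] ℤ.+ b) ⟩
    - 1# ⊕ fromℤ F (-[1+ n ] ℤ.+ b)       ≈⟨ +-congˡ (fromℤ-+ -[1+ n ] b) ⟩
    - 1# ⊕ (fromℤ F -[1+ n ] ⊕ fromℤ F b) ≈⟨ +-assoc (- 1#) _ _ ⟨
    - 1# ⊕ fromℤ F -[1+ n ] ⊕ fromℤ F b   ≈⟨ +-congʳ (fromℤ-pred -[1+ n ]) ⟨
    fromℤ F -[1+ suc n ] ⊕ fromℤ F b      ∎

  module _ {n : ℕ} (x : Vector Carrier n) where

    monomial : Vec ℕ n → Carrier
    monomial e = product (λ i → x i ^ lookup e i)

    monomial-* : ∀ e f → monomial (zipWith ℕ._+_ e f) ≈ monomial e ⊛ monomial f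
    monomial-* e f = begin
      monomial (zipWith ℕ._+_ e f)
        ≈⟨ product-cong (λ i → ≈-trans
             (≈-reflexive (cong (x i ^_) (Vecₚ.lookup-zipWith ℕ._+_ i e f)))
             (^-homo-* (x i) (lookup e i) (lookup f i))) ⟩
      product (λ i → x i ^ lookup e i ⊛ x i ^ lookup f i)
        ≈⟨ product-distrib-* (λ i → x i ^ lookup e i) (λ i → x i ^ lookup f i) ⟩
      monomial e ⊛ monomial f ∎

    eval : List (Vec ℕ n) → Carrier
    eval []      = 0#
    eval (e ∷ P) = monomial e ⊕ eval P

    eval-++ : ∀ P Q → eval (P ++ Q) ≈ eval P ⊕ eval Q
    eval-++ []      Q = ≈-sym (+-identityˡ (eval Q))
    eval-++ (e ∷ P) Q = ≈-trans (+-congˡ (eval-++ P Q)) (≈-sym (+-assoc _ _ _))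

    eval-map : ∀ e Q → eval (map (zipWith ℕ._+_ e) Q) ≈ monomial e ⊛ eval Q
    eval-map e []      = ≈-sym (≈-trans (*-comm _ _) (zeroˡ (monomial e)))
    eval-map e (f ∷ Q) =
      ≈-trans (+-cong (monomial-* e f) (eval-map e Q)) (≈-sym (distribˡ _ _ _))

    _⊗_ : List (Vec ℕ n) → List (Vec ℕ n) → List (Vec ℕ n)
    _⊗_ = cartesianProductWith (zipWith ℕ._+_)

    eval-⊗ : ∀ P Q → eval (P ⊗ Q) ≈ eval P ⊛ eval Q
    eval-⊗ []      Q = ≈-sym (zeroˡ (eval Q))
    eval-⊗ (e ∷ P) Q = begin
      eval (map (zipWith ℕ._+_ e) Q ++ P ⊗ Q)  ≈⟨ eval-++ (map (zipWith ℕ._+_ e) Q) (P ⊗ Q) ⟩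
      eval (map (zipWith ℕ._+_ e) Q) ⊕ eval (P ⊗ Q)  ≈⟨ +-cong (eval-map e Q) (eval-⊗ P Q) ⟩
      monomial e ⊛ eval Q ⊕ eval P ⊛ eval Q   ≈⟨ distribʳ (eval Q) (monomial e) (eval P) ⟨
      (monomial e ⊕ eval P) ⊛ eval Q          ∎

    evalPoly-addTerm : ∀ a e p →
      evalPoly F (addTerm a e p) x ≈ fromℤ F a ⊛ monomial e ⊕ evalPoly F p x
    evalPoly-addTerm a e [] = ≈-refl
    evalPoly-addTerm a e ((b , f) ∷ p) with Vecₚ.≡-dec ℕₚ._≟_ e f
    ... | yes refl = begin
      fromℤ F (a ℤ.+ b) ⊛ monomial e ⊕ evalPoly F p x
        ≈⟨ +-congʳ (≈-trans (*-congʳ (fromℤ-+ a b)) (distribʳ _ _ _)) ⟩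
      fromℤ F a ⊛ monomial e ⊕ fromℤ F b ⊛ monomial e ⊕ evalPoly F p x
        ≈⟨ +-assoc _ _ _ ⟩
      fromℤ F a ⊛ monomial e ⊕ (fromℤ F b ⊛ monomial e ⊕ evalPoly F p x) ∎
    ... | no _ = ≈-trans (+-congˡ (evalPoly-addTerm a e p)) (+S.x∙yz≈y∙xz _ _ _)

    evalPoly-collect : ∀ p → evalPoly F (collect p) x ≈ evalPoly F p x
    evalPoly-collect []            = ≈-refl
    evalPoly-collect ((a , e) ∷ p) =
      ≈-trans (evalPoly-addTerm a e (collect p)) (+-congˡ (evalPoly-collect p))

    evalPoly-difference : ∀ P Q → evalPoly F (difference P Q) x ⊕ eval Q ≈ eval P
    evalPoly-difference []      []      = +-identityˡ 0#
    evalPoly-difference []      (e ∷ Q) = begin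
      fromℤ F -1ℤ ⊛ u ⊕ D ⊕ (u ⊕ eval Q)   ≈⟨ +S.interchange _ _ _ _ ⟩
      (fromℤ F -1ℤ ⊛ u ⊕ u) ⊕ (D ⊕ eval Q) ≈⟨ +-cong (+-congʳ -1*u) (evalPoly-difference [] Q) ⟩
      (- u ⊕ u) ⊕ 0#                       ≈⟨ +-identityʳ _ ⟩
      - u ⊕ u                              ≈⟨ -‿inverseˡ u ⟩
      0#                                   ∎
      where
      u = monomial e
      D = evalPoly F (difference [] Q) x
      -1*u : fromℤ F -1ℤ ⊛ u ≈ - u
      -1*u = ≈-trans (*-congʳ fromℤ-neg1) (-1*x≈-x u)
    evalPoly-difference (e ∷ P) Q = begin
      fromℤ F 1ℤ ⊛ monomial e ⊕ evalPoly F (difference P Q) x ⊕ eval Q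
        ≈⟨ +-assoc _ _ _ ⟩
      fromℤ F 1ℤ ⊛ monomial e ⊕ (evalPoly F (difference P Q) x ⊕ eval Q)
        ≈⟨ +-cong (≈-trans (*-congʳ (+-identityʳ 1#)) (*-identityˡ _)) (evalPoly-difference P Q) ⟩
      monomial e ⊕ eval P ∎

    -- This makes the substitution of 1 for the variables well defined: P - Q vanishes at x, so all
    -- its collected coefficients are 0, and so is their sum, the number of monomials of P minus
    -- that of Q.
    independent⇒length-≡ : AlgebraicallyIndependent F x →
                            ∀ P Q → eval P ≈ eval Q → length P ≡ length Q
    independent⇒length-≡ independent P Q P≈Q = ℤₚ.+-injective
      (trans (sym (coefficientSum-difference P Q)) (cong (ℤ._+ (+ length Q)) sum≡0))
      where
      D = difference P Q

      D≈0 : evalPoly F (collect D) x ≈ 0#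
      D≈0 = begin
        evalPoly F (collect D) x  ≈⟨ evalPoly-collect D ⟩
        evalPoly F D x            ≈⟨ +-identityʳ _ ⟨
        evalPoly F D x ⊕ 0#       ≈⟨ +-congˡ (-‿inverseʳ (eval Q)) ⟨
        evalPoly F D x ⊕ (eval Q ⊕ - eval Q)  ≈⟨ +-assoc _ _ _ ⟨
        evalPoly F D x ⊕ eval Q ⊕ - eval Q    ≈⟨ +-congʳ (≈-trans (evalPoly-difference P Q) P≈Q) ⟩
        eval Q ⊕ - eval Q         ≈⟨ -‿inverseʳ (eval Q) ⟩
        0#                        ∎

      sum≡0 : coefficientSum D ≡ 0ℤ
      sum≡0 = trans (sym (coefficientSum-collect D))
        (coefficientSum-zero (independent (collect D) (collect-unique D) D≈0))

    monomial-replicate-0 : monomial (replicate n 0) ≈ 1#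
    monomial-replicate-0 = ≈-trans
      (product-cong (λ i → ≈-reflexive (cong (x i ^_) (Vecₚ.lookup-replicate i 0))))
      (product-1 n)

  monomial-unitVec : ∀ {n} (x : Vector Carrier n) i → monomial x (unitVec i) ≈ x i
  monomial-unitVec {suc n} x zero = begin
    x zero ⊛ 1# ⊛ monomial (x ∘ suc) (replicate n 0)
      ≈⟨ *-cong (*-identityʳ _) (monomial-replicate-0 (x ∘ suc)) ⟩
    x zero ⊛ 1#  ≈⟨ *-identityʳ _ ⟩
    x zero       ∎
  monomial-unitVec x (suc i) = ≈-trans (*-identityˡ _) (monomial-unitVec (x ∘ suc) i)

-- Positive fractions under the Q-system recursion

infixl 7 _·ᶠ_ _÷ᶠ_
infixl 6 _+ᶠ_
infix 4 _≃ᶠ_ _≼ᶠ_ _≺ᶠ_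

-- Numerator and denominator, never reduced: the components must equal the lengths of two lists of
-- monomials, and these lengths follow the arithmetic of unreduced fractions exactly.
Fraction : Set
Fraction = ℕ × ℕ

oneᶠ : Fraction
oneᶠ = 1 , 1

_·ᶠ_ _+ᶠ_ _÷ᶠ_ : Fraction → Fraction → Fraction
(p , q) ·ᶠ (p′ , q′) = p * p′ , q * q′
(p , q) +ᶠ (p′ , q′) = p * q′ + p′ * q , q * q′
(p , q) ÷ᶠ (p′ , q′) = p * q′ , q * p′

_≃ᶠ_ _≼ᶠ_ _≺ᶠ_ : Fraction → Fraction → Set
(p , q) ≃ᶠ (p′ , q′) = p * q′ ≡ p′ * q
(p , q) ≼ᶠ (p′ , q′) = p * q′ ≤ p′ * q
(p , q) ≺ᶠ (p′ , q′) = p * q′ < p′ * q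

Positiveᶠ : Fraction → Set
Positiveᶠ (p , q) = 0 < p × 0 < q

-- The Q-system relation solved for R_{α,n+1}, with `v₀`, `v₁` the values of R_{α,n-1}, R_{α,n} and
-- `u`, `w` those of the two neighbours at n.
nextᶠ : (v₀ v₁ u w : Fraction) → Fraction
nextᶠ v₀ v₁ u w = (v₁ ·ᶠ v₁ +ᶠ u ·ᶠ w) ÷ᶠ v₀

*-pos : ∀ {m n} → 0 < m → 0 < n → 0 < m * n
*-pos = ℕₚ.*-mono-≤

nextᶠ-positive : ∀ {v₀ v₁ u w} → Positiveᶠ v₀ → Positiveᶠ v₁ → Positiveᶠ u → Positiveᶠ w →
                 Positiveᶠ (nextᶠ v₀ v₁ u w)
nextᶠ-positive (p₀ , q₀) (p₁ , q₁) (s , t) (y , z) =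
  *-pos (ℕₚ.m≤n⇒m≤n+o _ (*-pos (*-pos p₁ p₁) (*-pos t z))) q₀ ,
  *-pos (*-pos (*-pos q₁ q₁) (*-pos t z)) p₀

-- v₁² < nextᶠ v₀ v₁ u w · v₀, so the ratio of consecutive values grows.
nextᶠ-increasing : ∀ {v₀ v₁ u w} → Positiveᶠ v₀ → Positiveᶠ v₁ → Positiveᶠ u → Positiveᶠ w →
                   v₀ ≼ᶠ v₁ → v₁ ≺ᶠ nextᶠ v₀ v₁ u w
nextᶠ-increasing {p₀ , q₀} {p₁ , q₁} {s , t} {y , z}
                 (0<p₀ , 0<q₀) (0<p₁ , 0<q₁) (0<s , 0<t) (0<y , 0<z) v₀≼v₁ = begin-strict
  p₁ * (q₁ * q₁ * (t * z) * p₀)  ≡⟨ left p₁ q₁ t z p₀ ⟩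
  (p₁ * q₁ * (t * z)) * (p₀ * q₁)  ≤⟨ ℕₚ.*-monoʳ-≤ (p₁ * q₁ * (t * z)) v₀≼v₁ ⟩
  (p₁ * q₁ * (t * z)) * (p₁ * q₀)
    <⟨ ℕₚ.m<m+n _ (*-pos (*-pos (*-pos 0<s 0<y) (*-pos 0<q₁ 0<q₁)) (*-pos 0<q₀ 0<q₁)) ⟩
  (p₁ * q₁ * (t * z)) * (p₁ * q₀) + (s * y) * (q₁ * q₁) * (q₀ * q₁)
    ≡⟨ right p₁ q₁ t z q₀ s y ⟩
  (p₁ * p₁ * (t * z) + s * y * (q₁ * q₁)) * q₀ * q₁  ∎
  where
  open ℕₚ.≤-Reasoning
  open +-*-Solver
  left : ∀ p₁ q₁ t z p₀ → p₁ * (q₁ * q₁ * (t * z) * p₀) ≡ (p₁ * q₁ * (t * z)) * (p₀ * q₁)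
  left = solve 5 (λ p₁ q₁ t z p₀ → p₁ :* (q₁ :* q₁ :* (t :* z) :* p₀)
                    := (p₁ :* q₁ :* (t :* z)) :* (p₀ :* q₁)) refl
  right : ∀ p₁ q₁ t z q₀ s y → (p₁ * q₁ * (t * z)) * (p₁ * q₀) + (s * y) * (q₁ * q₁) * (q₀ * q₁)
            ≡ (p₁ * p₁ * (t * z) + s * y * (q₁ * q₁)) * q₀ * q₁
  right = solve 7 (λ p₁ q₁ t z q₀ s y →
            (p₁ :* q₁ :* (t :* z)) :* (p₁ :* q₀) :+ (s :* y) :* (q₁ :* q₁) :* (q₀ :* q₁)
            := (p₁ :* p₁ :* (t :* z) :+ s :* y :* (q₁ :* q₁)) :* q₀ :* q₁) refl

≺ᶠ-trans : ∀ {u v w} → Positiveᶠ v → u ≺ᶠ v → v ≺ᶠ w → u ≺ᶠ w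
≺ᶠ-trans {p , q} {p′ , q′} {p″ , q″} (0<p′ , 0<q′) u≺v v≺w =
  ℕₚ.*-cancelˡ-< (p′ * q′) _ _
    (subst₂ _<_ (left p q′ p′ q″) (right p′ q p″ q′)
      (ℕₚ.*-mono-< u≺v v≺w))
  where
  open +-*-Solver
  left : ∀ p q′ p′ q″ → (p * q′) * (p′ * q″) ≡ p′ * q′ * (p * q″)
  left = solve 4 (λ p q′ p′ q″ → (p :* q′) :* (p′ :* q″) := p′ :* q′ :* (p :* q″)) refl
  right : ∀ p′ q p″ q′ → (p′ * q) * (p″ * q′) ≡ p′ * q′ * (p″ * q)
  right = solve 4 (λ p′ q p″ q′ → (p′ :* q) :* (p″ :* q′) := p′ :* q′ :* (p″ :* q)) refl

-- The Q-system with all initial variables equal to 1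

-- The recursion holds at inner labels only, while R is 1 at both ends. Neither `here i` nor the
-- last label is a constructor pattern, hence a view.
data Label {r : ℕ} : Fin (suc (suc r)) → Set where
  first : Label zero
  inner : ∀ i → Label (here i)
  last  : Label (fromℕ (suc r))

label : ∀ {r} (α : Fin (suc (suc r))) → Label α
label zero    = first
label (suc i) with view i
... | ‵fromℕ     = last
... | ‵inject₁ j = inner j

-- `label (here i)` is stuck on `view (inject₁ i)`; rewriting with this equation lets
-- `value (here i)` unfold.
label-here : ∀ {r} (i : Fin r) → label (here i) ≡ inner i
label-here i rewrite view-inject₁ i = refl

atInner : ∀ {a r} {A : Set a} {α : Fin (suc (suc r))} → Label α → A → (Fin r → A) → A
atInner first     x f = x
atInner (inner i) x f = f i
atInner last      x f = x

module _ {r : ℕ} where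

  -- The value of R α n, n ≥ 0, when all initial variables are set to 1.
  value : Fin (suc (suc r)) → ℕ → Fraction
  value α zero          = oneᶠ
  value α (suc zero)    = oneᶠ
  value α (suc (suc n)) = atInner (label α) oneᶠ λ i →
    nextᶠ (value (here i) n) (value (here i) (suc n))
          (value (above i) (suc n)) (value (below i) (suc n))

  value-positive : ∀ α n → Positiveᶠ (value α n)
  value-positive α zero          = s≤s z≤n , s≤s z≤n
  value-positive α (suc zero)    = s≤s z≤n , s≤s z≤n
  value-positive α (suc (suc n)) = atInner-positive (label α) λ i →
    nextᶠ-positive (value-positive (here i) n) (value-positive (here i) (suc n))
                   (value-positive (above i) (suc n)) (value-positive (below i) (suc n))
    where
    atInner-positive : ∀ {α : Fin (suc (suc r))} (l : Label α) {f} →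
                       (∀ i → Positiveᶠ (f i)) → Positiveᶠ (atInner l oneᶠ f)
    atInner-positive first     f = s≤s z≤n , s≤s z≤n
    atInner-positive (inner i) f = f i
    atInner-positive last      f = s≤s z≤n , s≤s z≤n

  -- The values at 0 and 1 are both 1, so strict growth starts at 1. One step needs only a weak
  -- inequality below it, and `nondecreasing` begins with 1 ≤ 1.
  value-increasing : ∀ (i : Fin r) n → value (here i) (suc n) ≺ᶠ value (here i) (suc (suc n))
  value-increasing i n rewrite label-here i =
    nextᶠ-increasing (value-positive (here i) n) (value-positive (here i) (suc n))
                     (value-positive (above i) (suc n)) (value-positive (below i) (suc n))
                     (nondecreasing n)
    where
    nondecreasing : ∀ n → value (here i) n ≼ᶠ value (here i) (suc n)
    nondecreasing zero    = ℕₚ.≤-refl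
    nondecreasing (suc n) = ℕₚ.<⇒≤ (value-increasing i n)

  value-mono-< : ∀ (i : Fin r) {m n} → suc m ℕ.≤′ n →
                 value (here i) (suc m) ≺ᶠ value (here i) (suc n)
  value-mono-< i {m} ℕ.≤′-refl           = value-increasing i m
  value-mono-< i {m} (ℕ.≤′-step {n} m<n) =
    ≺ᶠ-trans {value (here i) (suc m)} {value (here i) (suc n)} {value (here i) (suc (suc n))}
      (value-positive (here i) (suc n)) (value-mono-< i m<n) (value-increasing i n)

  value-injective : ∀ (i : Fin r) m n →
    value (here i) (suc m) ≃ᶠ value (here i) (suc n) → m ≡ n
  value-injective i m n eq with ℕₚ.<-cmp m n
  ... | tri≈ _ m≡n _ = m≡n
  ... | tri< m<n _ _ = contradiction eq (ℕₚ.<⇒≢ (value-mono-< i (ℕₚ.≤⇒≤′ m<n)))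
  ... | tri> _ _ n<m = contradiction (sym eq) (ℕₚ.<⇒≢ (value-mono-< i (ℕₚ.≤⇒≤′ n<m)))

-- 1 + depth n is the distance of n to the far one of 0 and 1.
depth : ℤ → ℕ
depth (+ zero)  = 0
depth +[1+ n ]  = n
depth -[1+ n ]  = suc n

suc⊖ : ∀ n → suc (suc n) ℤ.⊖ suc n ≡ 1ℤ
suc⊖ n = trans (ℤₚ.⊖-≥ (ℕₚ.n≤1+n (suc n))) (cong +_ (ℕₚ.m+n∸n≡m 1 n))

depth-injective : ∀ m n → depth m ≡ depth n → m ≡ n ⊎ m ℤ.+ n ≡ 1ℤ
depth-injective (+ zero) (+ zero)  eq   = inj₁ refl
depth-injective (+ zero) +[1+ n ]  refl = inj₂ refl
depth-injective +[1+ m ] (+ zero)  refl = inj₂ refl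
depth-injective +[1+ m ] +[1+ n ]  refl = inj₁ refl
depth-injective +[1+ m ] -[1+ n ]  refl = inj₂ (suc⊖ n)
depth-injective -[1+ m ] +[1+ n ]  refl = inj₂ (suc⊖ m)
depth-injective -[1+ m ] -[1+ n ]  refl = inj₁ refl

-- Transfer of the values to the field

module _ {c ℓ₁ ℓ₂ : Level} (F : HeytingField c ℓ₁ ℓ₂) where

  open Evaluation F renaming (_⊗_ to _⊠_)
  open import Relation.Binary.Reasoning.Setoid setoid
  private module *S = CommutativeSemigroupProperties *-commutativeSemigroup

  module _ {n : ℕ} (x : Vector Carrier n) where

    -- ρ is a quotient of two polynomials with natural coefficients whose
    -- values at (1,…,1), the numbers of their monomials, are p and q.
    HasValue : Carrier → Fraction → Set ℓ₁
    HasValue ρ (p , q) =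
      ∃[ P ] ∃[ Q ] length P ≡ p × length Q ≡ q × ρ ⊛ eval x Q ≈ eval x P

    private
      infixl 7 _⊗_
      _⊗_ = _⊠_ x
      length-⊗ = length-cartesianProductWith (zipWith {n = n} ℕ._+_)

    HasValue-≈ : ∀ {ρ σ v} → ρ ≈ σ → HasValue ρ v → HasValue σ v
    HasValue-≈ ρ≈σ (P , Q , refl , refl , eq) =
      P , Q , refl , refl , ≈-trans (*-congʳ (≈-sym ρ≈σ)) eq

    HasValue-monomial : ∀ e → HasValue (monomial x e) oneᶠ
    HasValue-monomial e = e ∷ [] , replicate n 0 ∷ [] , refl , refl , (begin
      monomial x e ⊛ (monomial x (replicate n 0) ⊕ 0#)
        ≈⟨ *-congˡ (≈-trans (+-identityʳ _) (monomial-replicate-0 x)) ⟩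
      monomial x e ⊛ 1#  ≈⟨ *-identityʳ _ ⟩
      monomial x e       ≈⟨ +-identityʳ _ ⟨
      monomial x e ⊕ 0#  ∎)

    HasValue-* : ∀ {ρ σ v w} → HasValue ρ v → HasValue σ w → HasValue (ρ ⊛ σ) (v ·ᶠ w)
    HasValue-* {ρ} {σ} (P , Q , refl , refl , eq) (P′ , Q′ , refl , refl , eq′) =
      P ⊗ P′ , Q ⊗ Q′ , length-⊗ P P′ , length-⊗ Q Q′ , (begin
        ρ ⊛ σ ⊛ eval x (Q ⊗ Q′)              ≈⟨ *-congˡ (eval-⊗ x Q Q′) ⟩
        ρ ⊛ σ ⊛ (eval x Q ⊛ eval x Q′)       ≈⟨ *S.interchange _ _ _ _ ⟩
        (ρ ⊛ eval x Q) ⊛ (σ ⊛ eval x Q′)     ≈⟨ *-cong eq eq′ ⟩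
        eval x P ⊛ eval x P′                 ≈⟨ eval-⊗ x P P′ ⟨
        eval x (P ⊗ P′)                      ∎)

    HasValue-+ : ∀ {ρ σ v w} → HasValue ρ v → HasValue σ w → HasValue (ρ ⊕ σ) (v +ᶠ w)
    HasValue-+ {ρ} {σ} (P , Q , refl , refl , eq) (P′ , Q′ , refl , refl , eq′) =
      P ⊗ Q′ ++ P′ ⊗ Q , Q ⊗ Q′ ,
      trans (length-++ (P ⊗ Q′)) (cong₂ _+_ (length-⊗ P Q′) (length-⊗ P′ Q)) ,
      length-⊗ Q Q′ , (begin
        (ρ ⊕ σ) ⊛ eval x (Q ⊗ Q′)            ≈⟨ *-congˡ (eval-⊗ x Q Q′) ⟩
        (ρ ⊕ σ) ⊛ (eval x Q ⊛ eval x Q′)     ≈⟨ distribʳ _ ρ σ ⟩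
        ρ ⊛ (eval x Q ⊛ eval x Q′) ⊕ σ ⊛ (eval x Q ⊛ eval x Q′)
          ≈⟨ +-cong (≈-sym (*-assoc _ _ _))
                    (≈-trans (*-congˡ (*-comm _ _)) (≈-sym (*-assoc _ _ _))) ⟩
        ρ ⊛ eval x Q ⊛ eval x Q′ ⊕ σ ⊛ eval x Q′ ⊛ eval x Q
          ≈⟨ +-cong (*-congʳ eq) (*-congʳ eq′) ⟩
        eval x P ⊛ eval x Q′ ⊕ eval x P′ ⊛ eval x Q
          ≈⟨ +-cong (eval-⊗ x P Q′) (eval-⊗ x P′ Q) ⟨
        eval x (P ⊗ Q′) ⊕ eval x (P′ ⊗ Q)    ≈⟨ eval-++ x (P ⊗ Q′) (P′ ⊗ Q) ⟨
        eval x (P ⊗ Q′ ++ P′ ⊗ Q)            ∎)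

    -- Dividing by ρ would require `ρ # 0#`. It is enough that τ solves τρ = σ, which is the form in
    -- which the Q-system relation presents R_{α,n+1}.
    HasValue-÷ : ∀ {τ ρ σ v w} → τ ⊛ ρ ≈ σ → HasValue σ v → HasValue ρ w → HasValue τ (v ÷ᶠ w)
    HasValue-÷ {τ} {ρ} {σ} τρ≈σ (P , Q , refl , refl , eq) (P′ , Q′ , refl , refl , eq′) =
      P ⊗ Q′ , Q ⊗ P′ , length-⊗ P Q′ , length-⊗ Q P′ , (begin
        τ ⊛ eval x (Q ⊗ P′)                ≈⟨ *-congˡ (eval-⊗ x Q P′) ⟩
        τ ⊛ (eval x Q ⊛ eval x P′)         ≈⟨ *-congˡ (*-congˡ eq′) ⟨
        τ ⊛ (eval x Q ⊛ (ρ ⊛ eval x Q′))   ≈⟨ *-congˡ (*S.x∙yz≈y∙xz _ _ _) ⟩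
        τ ⊛ (ρ ⊛ (eval x Q ⊛ eval x Q′))   ≈⟨ *-assoc _ _ _ ⟨
        τ ⊛ ρ ⊛ (eval x Q ⊛ eval x Q′)     ≈⟨ *-assoc _ _ _ ⟨
        τ ⊛ ρ ⊛ eval x Q ⊛ eval x Q′       ≈⟨ *-congʳ (≈-trans (*-congʳ τρ≈σ) eq) ⟩
        eval x P ⊛ eval x Q′               ≈⟨ eval-⊗ x P Q′ ⟨
        eval x (P ⊗ Q′)                    ∎)

    -- Evaluating ρ Q Q′ in two ways gives P Q′ = P′ Q with nothing cancelled; independence then
    -- equates the numbers of monomials.
    HasValue-unique : AlgebraicallyIndependent F x →
                      ∀ {ρ v w} → HasValue ρ v → HasValue ρ w → v ≃ᶠ w
    HasValue-unique independent {ρ} (P , Q , refl , refl , eq) (P′ , Q′ , refl , refl , eq′) =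
      subst₂ _≡_ (length-⊗ P Q′) (length-⊗ P′ Q)
        (independent⇒length-≡ x independent (P ⊗ Q′) (P′ ⊗ Q) (begin
          eval x (P ⊗ Q′)               ≈⟨ eval-⊗ x P Q′ ⟩
          eval x P ⊛ eval x Q′          ≈⟨ *-congʳ eq ⟨
          ρ ⊛ eval x Q ⊛ eval x Q′      ≈⟨ *S.xy∙z≈xz∙y _ _ _ ⟩
          ρ ⊛ eval x Q′ ⊛ eval x Q      ≈⟨ *-congʳ eq′ ⟩
          eval x P′ ⊛ eval x Q          ≈⟨ eval-⊗ x P′ Q ⟨
          eval x (P′ ⊗ Q)               ∎))

  module _ {r : ℕ} (Q : QSystem F r) where

    open QSystem Q

    private
      variablesHaveValue : ∀ k → HasValue x₀ (x₀ k) oneᶠ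
      variablesHaveValue k =
        HasValue-≈ x₀ (monomial-unitVec x₀ k) (HasValue-monomial x₀ (unitVec k))

    HasValue-1# : HasValue x₀ 1# oneᶠ
    HasValue-1# = HasValue-≈ x₀ (monomial-replicate-0 x₀) (HasValue-monomial x₀ (replicate _ 0))

    R₀-HasValue : ∀ i → HasValue x₀ (R (here i) 0ℤ) oneᶠ
    R₀-HasValue i =
      HasValue-≈ x₀ (≈-reflexive (Vectorₚ.lookup-++ˡ (λ α → R (here α) 0ℤ) (λ α → R (here α) 1ℤ) i))
        (variablesHaveValue (i ↑ˡ r))

    R₁-HasValue : ∀ i → HasValue x₀ (R (here i) 1ℤ) oneᶠ
    R₁-HasValue i =
      HasValue-≈ x₀ (≈-reflexive (Vectorₚ.lookup-++ʳ (λ α → R (here α) 0ℤ) (λ α → R (here α) 1ℤ) i))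
        (variablesHaveValue (r ↑ʳ i))

    atInner-HasValue : ∀ {k α} (l : Label α) {f} → (∀ i → HasValue x₀ (R (here i) k) (f i)) →
                       HasValue x₀ (R α k) (atInner l oneᶠ f)
    atInner-HasValue first     h = HasValue-≈ x₀ (≈-sym (R-first _)) HasValue-1#
    atInner-HasValue (inner i) h = h i
    atInner-HasValue last      h = HasValue-≈ x₀ (≈-sym (R-last _)) HasValue-1#

    constant-HasValue : ∀ {k α} → Label α → (∀ i → HasValue x₀ (R (here i) k) oneᶠ) →
                        HasValue x₀ (R α k) oneᶠ
    constant-HasValue first     h = atInner-HasValue first h
    constant-HasValue (inner i) h = h i
    constant-HasValue last      h = atInner-HasValue last h

    -- ν runs through the second indices 0, 1, 2, … or 1, 0, -1, …: both
    -- give the same values, since the Q-system is symmetric under n ↦ 1 - n.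
    module _ (ν : ℕ → ℤ)
             (ν₀ : ∀ i → HasValue x₀ (R (here i) (ν 0)) oneᶠ)
             (ν₁ : ∀ i → HasValue x₀ (R (here i) (ν 1)) oneᶠ)
             (recurrence : ∀ i n → R (here i) (ν (suc (suc n))) ⊛ R (here i) (ν n)
                 ≈ R (here i) (ν (suc n)) ⊛ R (here i) (ν (suc n))
                   ⊕ R (above i) (ν (suc n)) ⊛ R (below i) (ν (suc n)))
             where

      R-HasValue : ∀ n α → HasValue x₀ (R α (ν n)) (value α n)
      R-HasValue zero          α = constant-HasValue (label α) ν₀
      R-HasValue (suc zero)    α = constant-HasValue (label α) ν₁
      R-HasValue (suc (suc n)) α = atInner-HasValue (label α) λ i →
        HasValue-÷ x₀ (recurrence i n)
          (HasValue-+ x₀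
            (HasValue-* x₀ (R-HasValue (suc n) (here i)) (R-HasValue (suc n) (here i)))
            (HasValue-* x₀ (R-HasValue (suc n) (above i)) (R-HasValue (suc n) (below i))))
          (R-HasValue n (here i))

    R-HasValue⁺ : ∀ n α → HasValue x₀ (R α (+ n)) (value α n)
    R-HasValue⁺ = R-HasValue +_ R₀-HasValue R₁-HasValue λ i n → begin
      R (here i) (+ suc (suc n)) ⊛ R (here i) (+ n)
        ≡⟨ cong (λ k → R (here i) (+ suc k) ⊛ R (here i) (+ n)) (ℕₚ.+-comm 1 n) ⟩
      R (here i) (+ suc n ℤ.+ 1ℤ) ⊛ R (here i) (+ suc n ℤ.- 1ℤ)
        ≈⟨ R-relation i (+ suc n) ⟩
      -- The square unfolds to a product whose last factor is `1#`.
      _ ≈⟨ +-congʳ (*-congˡ (*-identityʳ _)) ⟩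
      _ ∎

    R-HasValue⁻ : ∀ n α → HasValue x₀ (R α (1ℤ ℤ.- + n)) (value α n)
    R-HasValue⁻ = R-HasValue (λ n → 1ℤ ℤ.- + n) R₁-HasValue R₀-HasValue λ i n → begin
      R (here i) (1ℤ ℤ.- + suc (suc n)) ⊛ R (here i) (1ℤ ℤ.- + n)
        ≈⟨ *-comm _ _ ⟩
      R (here i) (1ℤ ℤ.- + n) ⊛ R (here i) (1ℤ ℤ.- + suc (suc n))
        ≡⟨ cong₂ (λ k l → R (here i) k ⊛ R (here i) l) (up n) (down n) ⟩
      R (here i) (1ℤ ℤ.- + suc n ℤ.+ 1ℤ) ⊛ R (here i) (1ℤ ℤ.- + suc n ℤ.- 1ℤ)
        ≈⟨ R-relation i (1ℤ ℤ.- + suc n) ⟩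
      _ ≈⟨ +-congʳ (*-congˡ (*-identityʳ _)) ⟩
      _ ∎
      where
      up : ∀ n → 1ℤ ℤ.- + n ≡ 1ℤ ℤ.- + suc n ℤ.+ 1ℤ
      up zero          = refl
      up (suc zero)    = refl
      up (suc (suc n)) = refl
      down : ∀ n → 1ℤ ℤ.- + suc (suc n) ≡ 1ℤ ℤ.- + suc n ℤ.- 1ℤ
      down zero    = refl
      down (suc n) = cong (λ k → -[1+ suc k ]) (sym (ℕₚ.+-identityʳ n))

    -- Every integer is reached at a positive position of one of the two sequences, 0 as 1 - 1:
    -- position 0 repeats the value of position 1 and would spoil injectivity.
    R-HasValue-depth : ∀ α n → HasValue x₀ (R α n) (value α (suc (depth n)))
    R-HasValue-depth α (+ zero) = R-HasValue⁻ 1 α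
    R-HasValue-depth α +[1+ n ] = R-HasValue⁺ (suc n) α
    R-HasValue-depth α -[1+ n ] = R-HasValue⁻ (suc (suc n)) α

    R-injective : ∀ (i : Fin r) m n → R (here i) m ≈ R (here i) n → m ≡ n ⊎ m ℤ.+ n ≡ 1ℤ
    R-injective i m n eq = depth-injective m n (value-injective i (depth m) (depth n)
      (HasValue-unique x₀ independent
        (HasValue-≈ x₀ eq (R-HasValue-depth (here i) m)) (R-HasValue-depth (here i) n)))

-- Matrix mutation in block form

mutateMatrix-cong : ∀ {n} (k : Fin n) {B B′ : Matrix n} → (∀ i j → B i j ≡ B′ i j) →
                    ∀ i j → mutateMatrix k B i j ≡ mutateMatrix k B′ i j
mutateMatrix-cong k B≗B′ i j
  rewrite B≗B′ i j | B≗B′ i k | B≗B′ k j = refl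

mutateMatrix-row : ∀ {n} (k : Fin n) (B : Matrix n) j → mutateMatrix k B k j ≡ ℤ.- B k j
mutateMatrix-row k B j rewrite dec-true (k Finₚ.≟ k) refl = refl

mutateMatrix-column : ∀ {n} (k : Fin n) (B : Matrix n) i → mutateMatrix k B i k ≡ ℤ.- B i k
mutateMatrix-column k B i
  rewrite dec-true (k Finₚ.≟ k) refl | ∨-zeroʳ (does (i Finₚ.≟ k)) = refl

mutateMatrix-off : ∀ {n} (k : Fin n) (B : Matrix n) {i j} → i ≢ k → j ≢ k →
  mutateMatrix k B i j ≡ B i j ℤ.+ sgn (B i k) ℤ.* [ B i k ℤ.* B k j ]₊
mutateMatrix-off k B {i} {j} i≢k j≢k
  rewrite dec-false (i Finₚ.≟ k) i≢k | dec-false (j Finₚ.≟ k) j≢k = refl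

-- The two halves of the index set are the images of v and w; the mutation
-- is at an index v α that has no arrow to or from any other v i.
module _ {n r : ℕ} {v w : Fin r → Fin n}
         (v-injective : ∀ {i j} → v i ≡ v j → i ≡ j)
         (w≢v : ∀ i j → w i ≢ v j)
         (cover : ∀ k → (∃[ i ] k ≡ v i) ⊎ (∃[ i ] k ≡ w i))
         (α : Fin r) {B B′ : Matrix n}
         (vv-column : ∀ i → B (v i) (v α) ≡ 0ℤ)
         (vv-row : ∀ j → B (v α) (v j) ≡ 0ℤ)
         (vv : ∀ i j → B′ (v i) (v j) ≡ B (v i) (v j))
         (vw-row : ∀ j → B′ (v α) (w j) ≡ ℤ.- B (v α) (w j))
         (vw : ∀ {i} j → i ≢ α → B′ (v i) (w j) ≡ B (v i) (w j))
         (wv-column : ∀ i → B′ (w i) (v α) ≡ ℤ.- B (w i) (v α))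
         (wv : ∀ i {j} → j ≢ α → B′ (w i) (v j) ≡ B (w i) (v j))
         (ww : ∀ i j → B′ (w i) (w j) ≡
                 B (w i) (w j) ℤ.+ sgn (B (w i) (v α)) ℤ.* [ B (w i) (v α) ℤ.* B (v α) (w j) ]₊)
         where

  private
    zero-column : ∀ {x y z} → y ≡ 0ℤ → x ℤ.+ sgn y ℤ.* [ y ℤ.* z ]₊ ≡ x
    zero-column {x} refl = ℤₚ.+-identityʳ x

    zero-row : ∀ {x y z} → z ≡ 0ℤ → x ℤ.+ sgn y ℤ.* [ y ℤ.* z ]₊ ≡ x
    zero-row {x} {y} refl = trans
      (cong (λ u → x ℤ.+ sgn y ℤ.* [ u ]₊) (ℤₚ.*-zeroʳ y))
      (trans (cong (ℤ._+_ x) (ℤₚ.*-zeroʳ (sgn y))) (ℤₚ.+-identityʳ x))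

    v≢ : ∀ {i} → i ≢ α → v i ≢ v α
    v≢ i≢α = i≢α ∘ v-injective

  -- The positive-part term needs an arrow at the pivot from both indices, so only pairs in the half
  -- `w` receive it. The pivot's row and column inside `v` are zero and survive negation. With `v`
  -- and `w` abstract, even and odd pivots are two instances.
  mutateMatrix-blocks : ∀ k l → mutateMatrix (v α) B k l ≡ B′ k l
  mutateMatrix-blocks k l with cover k | cover l
  mutateMatrix-blocks _ _ | inj₁ (i , refl) | inj₁ (j , refl) with i Finₚ.≟ α | j Finₚ.≟ α
  ... | yes refl | _        = trans (mutateMatrix-row (v α) B (v j))
        (trans (cong ℤ.-_ (vv-row j)) (sym (trans (vv α j) (vv-row j))))
  ... | no _     | yes refl = trans (mutateMatrix-column (v α) B (v i))
        (trans (cong ℤ.-_ (vv-column i)) (sym (trans (vv i α) (vv-column i))))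
  ... | no i≢α   | no j≢α   = trans (mutateMatrix-off (v α) B (v≢ i≢α) (v≢ j≢α))
        (trans (zero-column (vv-column i)) (sym (vv i j)))
  mutateMatrix-blocks _ _ | inj₁ (i , refl) | inj₂ (j , refl) with i Finₚ.≟ α
  ... | yes refl = trans (mutateMatrix-row (v α) B (w j)) (sym (vw-row j))
  ... | no i≢α   = trans (mutateMatrix-off (v α) B (v≢ i≢α) (w≢v j α))
        (trans (zero-column (vv-column i)) (sym (vw j i≢α)))
  mutateMatrix-blocks _ _ | inj₂ (i , refl) | inj₁ (j , refl) with j Finₚ.≟ α
  ... | yes refl = trans (mutateMatrix-column (v α) B (w i)) (sym (wv-column i))
  ... | no j≢α   = trans (mutateMatrix-off (v α) B (w≢v i α) (v≢ j≢α))
        (trans (zero-row {y = B (w i) (v α)} (vv-row j)) (sym (wv i j≢α)))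
  mutateMatrix-blocks _ _ | inj₂ (i , refl) | inj₂ (j , refl) =
    trans (mutateMatrix-off (v α) B (w≢v i α) (w≢v j α)) (sym (ww i j))

-- Exchange matrices built from signs

-- Powers of -1 are kept as elements of `Sign`, so that an identity between matrix entries becomes
-- finitely many cases closed by `refl`.
⟦_⟧ : Sign → ℤ
⟦ pos ⟧ = 1ℤ
⟦ neg ⟧ = -1ℤ

-⟦⟧ : ∀ s z → ⟦ opposite s ⟧ ℤ.* z ≡ ℤ.- (⟦ s ⟧ ℤ.* z)
-⟦⟧ pos z = trans (ℤₚ.-1*i≡-i z) (cong ℤ.-_ (sym (ℤₚ.*-identityˡ z)))
-⟦⟧ neg z = trans (ℤₚ.*-identityˡ z)
  (sym (trans (cong ℤ.-_ (ℤₚ.-1*i≡-i z)) (ℤₚ.neg-involutive z)))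

opposite-*ʳ : ∀ s t → s *ₛ opposite t ≡ opposite (s *ₛ t)
opposite-*ʳ pos t = refl
opposite-*ʳ neg t = refl

opposite-*ˡ : ∀ s t → opposite s *ₛ t ≡ opposite (s *ₛ t)
opposite-*ˡ pos t = refl
opposite-*ˡ neg pos = refl
opposite-*ˡ neg neg = refl

dist : ∀ {r} → Fin r → Fin r → ℕ
dist i j = ∣ toℕ i - toℕ j ∣

dist-refl : ∀ {r} (i : Fin r) → dist i i ≡ 0
dist-refl i = ℕₚ.∣n-n∣≡0 (toℕ i)

dist-sym : ∀ {r} (i j : Fin r) → dist i j ≡ dist j i
dist-sym i j = ℕₚ.∣-∣-comm (toℕ i) (toℕ j)

dist-≢ : ∀ {r} {i j : Fin r} → i ≢ j → dist i j ≢ 0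
dist-≢ i≢j = i≢j ∘ Finₚ.toℕ-injective ∘ ℕₚ.∣m-n∣≡0⇒m≡n

dist-≡1⇒≢ : ∀ {r} {i j : Fin r} → dist i j ≡ 1 → i ≢ j
dist-≡1⇒≢ {i = i} eq refl = contradiction (trans (sym (dist-refl i)) eq) (λ ())

-- Apart from the signs, an entry depends on its indices only through their distance, so the
-- distance is an argument to split on.
differenceEntry : (s t u : Sign) → ℕ → ℤ
differenceEntry s t u d = ⟦ s ⟧ ℤ.* (⟦ t ⟧ ℤ.- ⟦ u ⟧) ℤ.* δ d 1

differenceEntry-cong : ∀ {s s′ t t′ u u′} d → s ≡ s′ → t ≡ t′ → u ≡ u′ →
                       differenceEntry s t u d ≡ differenceEntry s′ t′ u′ d
differenceEntry-cong d refl refl refl = refl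

cartanSignEntry : Sign → ℕ → ℤ
cartanSignEntry s d = ⟦ s ⟧ ℤ.* cartanEntry d

module _ {r : ℕ} where

  -- The matrix Bᴹ with a i = (-1)^⌊mᵢ/2⌋ and b i = (-1)^⌊(mᵢ+1)/2⌋.
  evenEven evenOdd oddEven oddOdd : (a b : Fin r → Sign) → Matrix r
  evenEven a b i j = differenceEntry (b j) (a i) (a j) (dist i j)
  evenOdd  a b i j = cartanSignEntry (opposite (b i *ₛ a j)) (dist i j)
  oddEven  a b i j = cartanSignEntry (a i *ₛ b j) (dist i j)
  oddOdd   a b i j = differenceEntry (a i) (b j) (b i) (dist i j)

  signMatrix : (a b : Fin r → Sign) → Matrix (r + r)
  signMatrix a b = blocks {r} (evenEven a b) (evenOdd a b) (oddEven a b) (oddOdd a b)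

  cover : ∀ (k : Fin (r + r)) → (∃[ i ] k ≡ i ↑ˡ r) ⊎ (∃[ i ] k ≡ r ↑ʳ i)
  cover k with splitAt r k in eq
  ... | inj₁ i = inj₁ (i , sym (Finₚ.splitAt⁻¹-↑ˡ eq))
  ... | inj₂ i = inj₂ (i , sym (Finₚ.splitAt⁻¹-↑ʳ eq))

  ↑ʳ≢↑ˡ : ∀ (i j : Fin r) → r ↑ʳ i ≢ j ↑ˡ r
  ↑ʳ≢↑ˡ i j eq
    with trans (sym (Finₚ.splitAt-↑ʳ r r i)) (trans (cong (splitAt r) eq) (Finₚ.splitAt-↑ˡ r j r))
  ... | ()

  module _ (P Q S T : Matrix r) where

    blocks-ˡˡ : ∀ i j → blocks P Q S T (i ↑ˡ r) (j ↑ˡ r) ≡ P i j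
    blocks-ˡˡ i j rewrite Finₚ.splitAt-↑ˡ r i r | Finₚ.splitAt-↑ˡ r j r = refl

    blocks-ˡʳ : ∀ i j → blocks P Q S T (i ↑ˡ r) (r ↑ʳ j) ≡ Q i j
    blocks-ˡʳ i j rewrite Finₚ.splitAt-↑ˡ r i r | Finₚ.splitAt-↑ʳ r r j = refl

    blocks-ʳˡ : ∀ i j → blocks P Q S T (r ↑ʳ i) (j ↑ˡ r) ≡ S i j
    blocks-ʳˡ i j rewrite Finₚ.splitAt-↑ʳ r r i | Finₚ.splitAt-↑ˡ r j r = refl

    blocks-ʳʳ : ∀ i j → blocks P Q S T (r ↑ʳ i) (r ↑ʳ j) ≡ T i j
    blocks-ʳʳ i j rewrite Finₚ.splitAt-↑ʳ r r i | Finₚ.splitAt-↑ʳ r r j = refl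

  blocks-cong : {P Q S T P′ Q′ S′ T′ : Matrix r} →
    (∀ i j → P i j ≡ P′ i j) → (∀ i j → Q i j ≡ Q′ i j) →
    (∀ i j → S i j ≡ S′ i j) → (∀ i j → T i j ≡ T′ i j) →
    ∀ k l → blocks P Q S T k l ≡ blocks P′ Q′ S′ T′ k l
  blocks-cong p q s t k l with splitAt r k | splitAt r l
  ... | inj₁ i | inj₁ j = p i j
  ... | inj₁ i | inj₂ j = q i j
  ... | inj₂ i | inj₁ j = s i j
  ... | inj₂ i | inj₂ j = t i j

  signMatrix-cong : ∀ {a b a′ b′ : Fin r → Sign} → (∀ i → a i ≡ a′ i) → (∀ i → b i ≡ b′ i) →
                    ∀ k l → signMatrix a b k l ≡ signMatrix a′ b′ k l
  signMatrix-cong {a} {b} {a′} {b′} a≗ b≗ = blocks-cong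
    (λ i j → differenceEntry-cong (dist i j) (b≗ j) (a≗ i) (a≗ j))
    (λ i j → cong₂ (λ s t → cartanSignEntry (opposite (s *ₛ t)) (dist i j)) (b≗ i) (a≗ j))
    (λ i j → cong₂ (λ s t → cartanSignEntry (s *ₛ t) (dist i j)) (a≗ i) (b≗ j))
    (λ i j → differenceEntry-cong (dist i j) (a≗ i) (b≗ j) (b≗ i))

-- The mutation term of tridiagonal entries

differenceEntry-zero : ∀ s t u d → (d ≡ 1 → t ≡ u) → differenceEntry s t u d ≡ 0ℤ
differenceEntry-zero s t u 0 _ = ℤₚ.*-zeroʳ (⟦ s ⟧ ℤ.* (⟦ t ⟧ ℤ.- ⟦ u ⟧))
differenceEntry-zero s t u (suc (suc d)) _ = ℤₚ.*-zeroʳ (⟦ s ⟧ ℤ.* (⟦ t ⟧ ℤ.- ⟦ u ⟧))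
differenceEntry-zero s t u 1 h with h refl
differenceEntry-zero pos pos _ 1 h | refl = refl
differenceEntry-zero pos neg _ 1 h | refl = refl
differenceEntry-zero neg pos _ 1 h | refl = refl
differenceEntry-zero neg neg _ 1 h | refl = refl

cartanSignEntry-opposite : ∀ s d → cartanSignEntry (opposite s) d ≡ ℤ.- cartanSignEntry s d
cartanSignEntry-opposite s d = -⟦⟧ s (cartanEntry d)

-- The term that mutation adds at (i, j), when i and j lie at distances d and e from the pivot's
-- label and their entries with the pivot are signed Cartan entries.
correction : Sign → ℕ → Sign → ℕ → ℤ
correction s d t e =
  sgn (cartanSignEntry s d) ℤ.* [ cartanSignEntry s d ℤ.* cartanSignEntry t e ]₊

correction-farˡ : ∀ s d t e → correction s (suc (suc d)) t e ≡ 0ℤ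
correction-farˡ s d t e rewrite ℤₚ.*-zeroʳ ⟦ s ⟧ = refl

correction-farʳ : ∀ s d t e → correction s d t (suc (suc e)) ≡ 0ℤ
correction-farʳ s d t e
  rewrite ℤₚ.*-zeroʳ ⟦ t ⟧ | ℤₚ.*-zeroʳ (cartanSignEntry s d) =
  ℤₚ.*-zeroʳ (sgn (cartanSignEntry s d))

-- Equal Cartan entries with opposite signs have a negative product: no path of arrows runs through
-- the pivot and the positive part is 0. The same holds at distance 0.
correction-near : ∀ s → correction s 1 (opposite s) 1 ≡ 0ℤ
correction-near pos = refl
correction-near neg = refl

correction-here : ∀ s → correction s 0 (opposite s) 0 ≡ 0ℤ
correction-here pos = refl
correction-here neg = refl

module _ {r : ℕ} (α : Fin r) {W W′ : Matrix r} (s t : Fin r → Sign)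
         (W-tridiagonal  : ∀ i j → dist i j ≢ 1 → W i j ≡ 0ℤ)
         (W′-tridiagonal : ∀ i j → dist i j ≢ 1 → W′ i j ≡ 0ℤ)
         (unchanged : ∀ {i j} → i ≢ α → j ≢ α → W′ i j ≡ W i j)
         (opposite-signs : t α ≡ opposite (s α))
         (opposite-signs-near : ∀ {i j} → dist i α ≡ 1 → dist α j ≡ 1 → t j ≡ opposite (s i))
         (row    : ∀ j → dist α j ≡ 1 → W′ α j ≡ W α j ℤ.+ correction (s α) 0 (t j) 1)
         (column : ∀ i → dist i α ≡ 1 → W′ i α ≡ W i α ℤ.+ correction (s i) 1 (t α) 0)
         where

  private
    add-zero : ∀ {x y z} → x ≡ y → z ≡ 0ℤ → x ≡ y ℤ.+ z
    add-zero refl refl = sym (ℤₚ.+-identityʳ _)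

    zero-zero : ∀ {i j} → dist i j ≢ 1 → W′ i j ≡ W i j
    zero-zero d≢1 = trans (W′-tridiagonal _ _ d≢1) (sym (W-tridiagonal _ _ d≢1))

    0≢1 : ∀ {d} → d ≡ 0 → d ≢ 1
    0≢1 refl ()

    2+≢1 : ∀ {d e} → d ≡ suc (suc e) → d ≢ 1
    2+≢1 refl ()

  -- A label at distance 2 or more has no arrow at the pivot, and by `opposite-signs` and
  -- `opposite-signs-near` nothing is added at (α, α) or between two neighbours of α. What is left
  -- is α paired with a neighbour, covered by `row` and `column`.
  tridiagonal-correction : ∀ i j →
    W′ i j ≡ W i j ℤ.+ correction (s i) (dist i α) (t j) (dist α j)
  tridiagonal-correction i j with i Finₚ.≟ α | j Finₚ.≟ α
  ... | yes refl | yes refl = add-zero (zero-zero {i} (0≢1 (dist-refl i))) corr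
    where
    corr : correction (s i) (dist i i) (t i) (dist i i) ≡ 0ℤ
    corr rewrite dist-refl i | opposite-signs = correction-here (s i)
  ... | yes refl | no j≢α = go (dist i j) refl
    where
    go : ∀ d → dist i j ≡ d → W′ i j ≡ W i j ℤ.+ correction (s i) (dist i i) (t j) (dist i j)
    go zero eq = contradiction eq (dist-≢ (j≢α ∘ sym))
    go (suc zero) eq = subst₂ (λ d e → W′ i j ≡ W i j ℤ.+ correction (s i) d (t j) e)
      (sym (dist-refl i)) (sym eq) (row j eq)
    go (suc (suc d)) eq = add-zero (zero-zero (2+≢1 eq))
      (trans (cong (correction (s i) (dist i i) (t j)) eq)
             (correction-farʳ (s i) (dist i i) (t j) d))
  ... | no i≢α | yes refl = go (dist i j) refl
    where
    go : ∀ d → dist i j ≡ d → W′ i j ≡ W i j ℤ.+ correction (s i) (dist i j) (t j) (dist j j)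
    go zero eq = contradiction eq (dist-≢ i≢α)
    go (suc zero) eq = subst₂ (λ d e → W′ i j ≡ W i j ℤ.+ correction (s i) d (t j) e)
      (sym eq) (sym (dist-refl j)) (column i eq)
    go (suc (suc d)) eq = add-zero (zero-zero (2+≢1 eq))
      (trans (cong (λ e → correction (s i) e (t j) (dist j j)) eq)
             (correction-farˡ (s i) d (t j) (dist j j)))
  ... | no i≢α | no j≢α = add-zero (unchanged i≢α j≢α) (go (dist i α) (dist α j) refl refl)
    where
    go : ∀ d e → dist i α ≡ d → dist α j ≡ e → correction (s i) d (t j) e ≡ 0ℤ
    go zero e eq _ = contradiction eq (dist-≢ i≢α)
    go d zero _ eq = contradiction eq (dist-≢ (j≢α ∘ sym))
    go (suc zero) (suc zero) eq eq′ rewrite opposite-signs-near eq eq′ = correction-near (s i)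
    go (suc (suc d)) e _ _ = correction-farˡ (s i) d (t j) e
    go d (suc (suc e)) _ _ = correction-farʳ (s i) d (t j) e

-- Mutation of the sign matrix at an even or odd variable

module _ {r : ℕ} (α : Fin r) (a b : Fin r → Sign) where

  private
    tridiagonal : ∀ s t u {d} → d ≢ 1 → differenceEntry s t u d ≡ 0ℤ
    tridiagonal s t u {d} d≢1 = differenceEntry-zero s t u d (λ d≡1 → contradiction d≡1 d≢1)

  signMatrix-mutate-even : (b′ : Fin r → Sign) →
    (∀ β → dist β α ≡ 1 → a β ≡ a α) →
    b′ α ≡ opposite (b α) → (∀ {β} → β ≢ α → b′ β ≡ b β) →
    ∀ k l → mutateMatrix (α ↑ˡ r) (signMatrix a b) k l ≡ signMatrix a b′ k l
  signMatrix-mutate-even b′ near flip fix = mutateMatrix-blocks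
    (Finₚ.↑ˡ-injective r _ _) ↑ʳ≢↑ˡ cover α
    (λ i → trans (ˡˡ i α) (column-zero (b α) i))
    (λ j → trans (ˡˡ α j) (row-zero (b j) j))
    (λ i j → trans (ˡˡ′ i j) (trans (vv i j) (sym (ˡˡ i j))))
    (λ j → trans (ˡʳ′ α j) (trans (vw-row j) (cong ℤ.-_ (sym (ˡʳ α j)))))
    (λ {i} j i≢α → trans (ˡʳ′ i j)
      (trans (cong (λ s → cartanSignEntry (opposite (s *ₛ a j)) (dist i j)) (fix i≢α))
             (sym (ˡʳ i j))))
    (λ i → trans (ʳˡ′ i α) (trans (wv-column i) (cong ℤ.-_ (sym (ʳˡ i α)))))
    (λ i {j} j≢α → trans (ʳˡ′ i j)
      (trans (cong (λ s → cartanSignEntry (a i *ₛ s) (dist i j)) (fix j≢α)) (sym (ʳˡ i j))))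
    (λ i j → trans (ʳʳ′ i j) (trans (ww i j)
      (sym (cong₂ ℤ._+_ (ʳʳ i j) (cong₂ (λ x y → sgn x ℤ.* [ x ℤ.* y ]₊) (ʳˡ i α) (ˡʳ α j))))))
    where
    ˡˡ  = blocks-ˡˡ (evenEven a b) (evenOdd a b) (oddEven a b) (oddOdd a b)
    ˡʳ  = blocks-ˡʳ (evenEven a b) (evenOdd a b) (oddEven a b) (oddOdd a b)
    ʳˡ  = blocks-ʳˡ (evenEven a b) (evenOdd a b) (oddEven a b) (oddOdd a b)
    ʳʳ  = blocks-ʳʳ (evenEven a b) (evenOdd a b) (oddEven a b) (oddOdd a b)
    ˡˡ′ = blocks-ˡˡ (evenEven a b′) (evenOdd a b′) (oddEven a b′) (oddOdd a b′)
    ˡʳ′ = blocks-ˡʳ (evenEven a b′) (evenOdd a b′) (oddEven a b′) (oddOdd a b′)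
    ʳˡ′ = blocks-ʳˡ (evenEven a b′) (evenOdd a b′) (oddEven a b′) (oddOdd a b′)
    ʳʳ′ = blocks-ʳʳ (evenEven a b′) (evenOdd a b′) (oddEven a b′) (oddOdd a b′)

    near′ : ∀ β → dist α β ≡ 1 → a β ≡ a α
    near′ β eq = near β (trans (dist-sym β α) eq)

    column-zero : ∀ s i → differenceEntry s (a i) (a α) (dist i α) ≡ 0ℤ
    column-zero s i = differenceEntry-zero s (a i) (a α) (dist i α) (near i)

    row-zero : ∀ s j → differenceEntry s (a α) (a j) (dist α j) ≡ 0ℤ
    row-zero s j = differenceEntry-zero s (a α) (a j) (dist α j) (sym ∘ near′ j)

    vv : ∀ i j → evenEven a b′ i j ≡ evenEven a b i j
    vv i j with j Finₚ.≟ α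
    -- Only here does the changed sign enter, and as a factor of a column that is zero before and
    -- after.
    ... | yes refl = trans (column-zero (b′ j) i) (sym (column-zero (b j) i))
    ... | no j≢α   = cong (λ s → differenceEntry s (a i) (a j) (dist i j)) (fix j≢α)

    vw-row : ∀ j → evenOdd a b′ α j ≡ ℤ.- evenOdd a b α j
    vw-row j rewrite flip | opposite-*ˡ (b α) (a j) =
      cartanSignEntry-opposite (opposite (b α *ₛ a j)) (dist α j)

    wv-column : ∀ i → oddEven a b′ i α ≡ ℤ.- oddEven a b i α
    wv-column i rewrite flip | opposite-*ʳ (a i) (b α) =
      cartanSignEntry-opposite (a i *ₛ b α) (dist i α)

    ww : ∀ i j → oddOdd a b′ i j ≡ oddOdd a b i j ℤ.+
           correction (a i *ₛ b α) (dist i α) (opposite (b α *ₛ a j)) (dist α j)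
    ww = tridiagonal-correction α (λ i → a i *ₛ b α) (λ j → opposite (b α *ₛ a j))
      (λ i j → tridiagonal (a i) (b j) (b i))
      (λ i j → tridiagonal (a i) (b′ j) (b′ i))
      (λ {i} {j} i≢α j≢α → cong₂ (λ s t → differenceEntry (a i) s t (dist i j)) (fix j≢α) (fix i≢α))
      (cong opposite (Signₚ.*-comm (b α) (a α)))
      (λ {i} {j} eq eq′ → cong opposite (trans (Signₚ.*-comm (b α) (a j))
        (cong (_*ₛ b α) (trans (near′ j eq′) (sym (near i eq))))))
      row column
      where
      row : ∀ j → dist α j ≡ 1 → oddOdd a b′ α j ≡ oddOdd a b α j ℤ.+
              correction (a α *ₛ b α) 0 (opposite (b α *ₛ a j)) 1
      -- As a agrees at j and α, the correction equals 2 a_α b_α, which is what a_α (b_j - b_α)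
      -- gains when b_α changes sign.
      row j eq rewrite eq | near′ j eq | flip | fix {j} (dist-≡1⇒≢ eq ∘ sym) =
        values (a α) (b α) (b j)
        where
        values : ∀ s t u → differenceEntry s u (opposite t) 1 ≡
          differenceEntry s u t 1 ℤ.+ correction (s *ₛ t) 0 (opposite (t *ₛ s)) 1
        values pos pos pos = refl
        values pos pos neg = refl
        values pos neg pos = refl
        values pos neg neg = refl
        values neg pos pos = refl
        values neg pos neg = refl
        values neg neg pos = refl
        values neg neg neg = refl
      column : ∀ i → dist i α ≡ 1 → oddOdd a b′ i α ≡ oddOdd a b i α ℤ.+
                 correction (a i *ₛ b α) 1 (opposite (b α *ₛ a α)) 0
      column i eq rewrite eq | near i eq | flip | fix {i} (dist-≡1⇒≢ eq) =
        values (a α) (b α) (b i)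
        where
        values : ∀ s t u → differenceEntry s (opposite t) u 1 ≡
          differenceEntry s t u 1 ℤ.+ correction (s *ₛ t) 1 (opposite (t *ₛ s)) 0
        values pos pos pos = refl
        values pos pos neg = refl
        values pos neg pos = refl
        values pos neg neg = refl
        values neg pos pos = refl
        values neg pos neg = refl
        values neg neg pos = refl
        values neg neg neg = refl

  signMatrix-mutate-odd : (a′ : Fin r → Sign) →
    (∀ β → dist β α ≡ 1 → b β ≡ b α) →
    a′ α ≡ opposite (a α) → (∀ {β} → β ≢ α → a′ β ≡ a β) →
    ∀ k l → mutateMatrix (r ↑ʳ α) (signMatrix a b) k l ≡ signMatrix a′ b k l
  signMatrix-mutate-odd a′ near flip fix = mutateMatrix-blocks
    (Finₚ.↑ʳ-injective r _ _) (λ i j → ↑ʳ≢↑ˡ j i ∘ sym) (swap ∘ cover) α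
    (λ i → trans (ʳʳ i α) (column-zero (a i) i))
    (λ j → trans (ʳʳ α j) (row-zero (a α) j))
    (λ i j → trans (ʳʳ′ i j) (trans (vv i j) (sym (ʳʳ i j))))
    (λ j → trans (ʳˡ′ α j) (trans (vw-row j) (cong ℤ.-_ (sym (ʳˡ α j)))))
    (λ {i} j i≢α → trans (ʳˡ′ i j)
      (trans (cong (λ s → cartanSignEntry (s *ₛ b j) (dist i j)) (fix i≢α)) (sym (ʳˡ i j))))
    (λ i → trans (ˡʳ′ i α) (trans (wv-column i) (cong ℤ.-_ (sym (ˡʳ i α)))))
    (λ i {j} j≢α → trans (ˡʳ′ i j)
      (trans (cong (λ s → cartanSignEntry (opposite (b i *ₛ s)) (dist i j)) (fix j≢α))
             (sym (ˡʳ i j))))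
    (λ i j → trans (ˡˡ′ i j) (trans (ww i j)
      (sym (cong₂ ℤ._+_ (ˡˡ i j) (cong₂ (λ x y → sgn x ℤ.* [ x ℤ.* y ]₊) (ˡʳ i α) (ʳˡ α j))))))
    where
    ˡˡ  = blocks-ˡˡ (evenEven a b) (evenOdd a b) (oddEven a b) (oddOdd a b)
    ˡʳ  = blocks-ˡʳ (evenEven a b) (evenOdd a b) (oddEven a b) (oddOdd a b)
    ʳˡ  = blocks-ʳˡ (evenEven a b) (evenOdd a b) (oddEven a b) (oddOdd a b)
    ʳʳ  = blocks-ʳʳ (evenEven a b) (evenOdd a b) (oddEven a b) (oddOdd a b)
    ˡˡ′ = blocks-ˡˡ (evenEven a′ b) (evenOdd a′ b) (oddEven a′ b) (oddOdd a′ b)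
    ˡʳ′ = blocks-ˡʳ (evenEven a′ b) (evenOdd a′ b) (oddEven a′ b) (oddOdd a′ b)
    ʳˡ′ = blocks-ʳˡ (evenEven a′ b) (evenOdd a′ b) (oddEven a′ b) (oddOdd a′ b)
    ʳʳ′ = blocks-ʳʳ (evenEven a′ b) (evenOdd a′ b) (oddEven a′ b) (oddOdd a′ b)

    near′ : ∀ β → dist α β ≡ 1 → b β ≡ b α
    near′ β eq = near β (trans (dist-sym β α) eq)

    column-zero : ∀ s i → differenceEntry s (b α) (b i) (dist i α) ≡ 0ℤ
    column-zero s i = differenceEntry-zero s (b α) (b i) (dist i α) (sym ∘ near i)

    row-zero : ∀ s j → differenceEntry s (b j) (b α) (dist α j) ≡ 0ℤ
    row-zero s j = differenceEntry-zero s (b j) (b α) (dist α j) (near′ j)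

    vv : ∀ i j → oddOdd a′ b i j ≡ oddOdd a b i j
    vv i j with i Finₚ.≟ α
    ... | yes refl = trans (row-zero (a′ i) j) (sym (row-zero (a i) j))
    ... | no i≢α   = cong (λ s → differenceEntry s (b j) (b i) (dist i j)) (fix i≢α)

    vw-row : ∀ j → oddEven a′ b α j ≡ ℤ.- oddEven a b α j
    vw-row j rewrite flip | opposite-*ˡ (a α) (b j) =
      cartanSignEntry-opposite (a α *ₛ b j) (dist α j)

    wv-column : ∀ i → evenOdd a′ b i α ≡ ℤ.- evenOdd a b i α
    wv-column i rewrite flip | opposite-*ʳ (b i) (a α) =
      cartanSignEntry-opposite (opposite (b i *ₛ a α)) (dist i α)

    ww : ∀ i j → evenEven a′ b i j ≡ evenEven a b i j ℤ.+
           correction (opposite (b i *ₛ a α)) (dist i α) (a α *ₛ b j) (dist α j)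
    ww = tridiagonal-correction α (λ i → opposite (b i *ₛ a α)) (λ j → a α *ₛ b j)
      (λ i j → tridiagonal (b j) (a i) (a j))
      (λ i j → tridiagonal (b j) (a′ i) (a′ j))
      (λ {i} {j} i≢α j≢α → cong₂ (λ s t → differenceEntry (b j) s t (dist i j)) (fix i≢α) (fix j≢α))
      (trans (Signₚ.*-comm (a α) (b α)) (sym (Signₚ.opposite-involutive _)))
      (λ {i} {j} eq eq′ → trans (Signₚ.*-comm (a α) (b j))
        (trans (cong (_*ₛ a α) (trans (near′ j eq′) (sym (near i eq))))
               (sym (Signₚ.opposite-involutive _))))
      row column
      where
      row : ∀ j → dist α j ≡ 1 → evenEven a′ b α j ≡ evenEven a b α j ℤ.+
              correction (opposite (b α *ₛ a α)) 0 (a α *ₛ b j) 1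
      row j eq rewrite eq | near′ j eq | flip | fix {j} (dist-≡1⇒≢ eq ∘ sym) =
        values (b α) (a α) (a j)
        where
        values : ∀ s t u → differenceEntry s (opposite t) u 1 ≡
          differenceEntry s t u 1 ℤ.+ correction (opposite (s *ₛ t)) 0 (t *ₛ s) 1
        values pos pos pos = refl
        values pos pos neg = refl
        values pos neg pos = refl
        values pos neg neg = refl
        values neg pos pos = refl
        values neg pos neg = refl
        values neg neg pos = refl
        values neg neg neg = refl

      column : ∀ i → dist i α ≡ 1 → evenEven a′ b i α ≡ evenEven a b i α ℤ.+
                 correction (opposite (b i *ₛ a α)) 1 (a α *ₛ b α) 0
      column i eq rewrite eq | near i eq | flip | fix {i} (dist-≡1⇒≢ eq) =
        values (b α) (a α) (a i)
        where
        values : ∀ s t u → differenceEntry s u (opposite t) 1 ≡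
          differenceEntry s u t 1 ℤ.+ correction (opposite (s *ₛ t)) 1 (t *ₛ s) 0
        values pos pos pos = refl
        values pos pos neg = refl
        values pos neg pos = refl
        values pos neg neg = refl
        values neg pos pos = refl
        values neg pos neg = refl
        values neg neg pos = refl
        values neg neg neg = refl

-- Parity and integer halves

double≢1 : ∀ z → z ℤ.* + 2 ≢ 1ℤ
double≢1 z eq with ℤ.∣ z ∣ | trans (sym (ℤₚ.abs-* z (+ 2))) (cong ℤ.∣_∣ eq)
... | zero  | ()
... | suc n | ()

double≢double+1 : ∀ h k → h ℤ.* + 2 ≢ k ℤ.* + 2 ℤ.+ 1ℤ
double≢double+1 h k eq = double≢1 (h ℤ.- k)
  (trans (expand h k) (trans (cong (ℤ._- k ℤ.* + 2) eq) (cancel k)))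
  where
  open ℤ-Solver
  expand : ∀ h k → (h ℤ.- k) ℤ.* + 2 ≡ h ℤ.* + 2 ℤ.- k ℤ.* + 2
  expand = solve 2 (λ h k → (h :- k) :* con (+ 2) := h :* con (+ 2) :- k :* con (+ 2)) refl
  cancel : ∀ k → k ℤ.* + 2 ℤ.+ 1ℤ ℤ.- k ℤ.* + 2 ≡ 1ℤ
  cancel = solve 1 (λ k → k :* con (+ 2) :+ con 1ℤ :- k :* con (+ 2) := con 1ℤ) refl

-- The remainder accompanies the equation because `evenOf` and `oddOf` branch on it and unfold only
-- after rewriting with it.
parity : ∀ m → (m %ℕ 2 ≡ 0 × m ≡ ⌊ m /2⌋ ℤ.* + 2) ⊎ (m %ℕ 2 ≡ 1 × m ≡ ⌊ m /2⌋ ℤ.* + 2 ℤ.+ 1ℤ)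
parity m with m %ℕ 2 | n%ℕd<d m 2 | a≡a%ℕn+[a/ℕn]*n m 2
... | 0 | _ | eq = inj₁ (refl , trans eq (ℤₚ.+-identityˡ _))
... | 1 | _ | eq = inj₂ (refl , trans eq (ℤₚ.+-comm 1ℤ (⌊ m /2⌋ ℤ.* + 2)))
... | suc (suc _) | s≤s (s≤s ()) | _

⌊/2⌋-even : ∀ {m} h → m ≡ h ℤ.* + 2 → ⌊ m /2⌋ ≡ h
⌊/2⌋-even {m} h eq with parity m
... | inj₁ (_ , eq′) = ℤₚ.*-cancelʳ-≡ _ _ (+ 2) (trans (sym eq′) eq)
... | inj₂ (_ , eq′) = contradiction (trans (sym eq) eq′) (double≢double+1 h ⌊ m /2⌋)

⌊/2⌋-odd : ∀ {m} h → m ≡ h ℤ.* + 2 ℤ.+ 1ℤ → ⌊ m /2⌋ ≡ h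
⌊/2⌋-odd {m} h eq with parity m
... | inj₁ (_ , eq′) = contradiction (trans (sym eq′) eq) (double≢double+1 ⌊ m /2⌋ h)
... | inj₂ (_ , eq′) = ℤₚ.*-cancelʳ-≡ _ _ (+ 2) (∙-cancelʳ 1ℤ _ _ (trans (sym eq′) eq))

double-suc : ∀ h → h ℤ.* + 2 ℤ.+ 1ℤ ℤ.+ 1ℤ ≡ (h ℤ.+ 1ℤ) ℤ.* + 2
double-suc = solve 1 (λ h → h :* con (+ 2) :+ con 1ℤ :+ con 1ℤ := (h :+ con 1ℤ) :* con (+ 2)) refl
  where open ℤ-Solver

⌊/2⌋-suc : ∀ m → (m ≡ ⌊ m /2⌋ ℤ.* + 2 × ⌊ m ℤ.+ 1ℤ /2⌋ ≡ ⌊ m /2⌋)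
               ⊎ (m ≡ ⌊ m /2⌋ ℤ.* + 2 ℤ.+ 1ℤ × ⌊ m ℤ.+ 1ℤ /2⌋ ≡ ⌊ m /2⌋ ℤ.+ 1ℤ)
⌊/2⌋-suc m with parity m
... | inj₁ (_ , eq) = inj₁ (eq , ⌊/2⌋-odd ⌊ m /2⌋ (cong (ℤ._+ 1ℤ) eq))
... | inj₂ (_ , eq) = inj₂ (eq , ⌊/2⌋-even (⌊ m /2⌋ ℤ.+ 1ℤ)
                              (trans (cong (ℤ._+ 1ℤ) eq) (double-suc ⌊ m /2⌋)))

⌊/2⌋-+2 : ∀ m → ⌊ m ℤ.+ 1ℤ ℤ.+ 1ℤ /2⌋ ≡ ⌊ m /2⌋ ℤ.+ 1ℤ
⌊/2⌋-+2 m with parity m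
... | inj₁ (_ , eq) = ⌊/2⌋-even _ (trans (cong (λ k → k ℤ.+ 1ℤ ℤ.+ 1ℤ) eq) (double-suc ⌊ m /2⌋))
... | inj₂ (_ , eq) = ⌊/2⌋-odd _ (trans (cong (λ k → k ℤ.+ 1ℤ ℤ.+ 1ℤ) eq)
                                        (cong (ℤ._+ 1ℤ) (double-suc ⌊ m /2⌋)))

-- The link between clusters and signs: the odd index determines ⌊m/2⌋ and the even index, by
-- `evenOf≡`, determines ⌊(m+1)/2⌋.
oddOf≡ : ∀ m → oddOf m ≡ ⌊ m /2⌋ ℤ.* + 2 ℤ.+ 1ℤ
oddOf≡ m with parity m
... | inj₁ (rem , eq) rewrite rem = cong (ℤ._+ 1ℤ) eq
... | inj₂ (rem , eq) rewrite rem = eq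

evenOf≡ : ∀ m → evenOf m ≡ ⌊ m ℤ.+ 1ℤ /2⌋ ℤ.* + 2
evenOf≡ m with parity m
... | inj₁ (rem , eq) rewrite rem =
  trans eq (cong (ℤ._* + 2) (sym (⌊/2⌋-odd ⌊ m /2⌋ (cong (ℤ._+ 1ℤ) eq))))
... | inj₂ (rem , eq) rewrite rem =
  trans m+1≡ (cong (ℤ._* + 2) (sym (⌊/2⌋-even (⌊ m /2⌋ ℤ.+ 1ℤ) m+1≡)))
  where m+1≡ = trans (cong (ℤ._+ 1ℤ) eq) (double-suc ⌊ m /2⌋)

-- The two halves together recover m, so paths with the same even and odd index at a label agree
-- there.
⌊/2⌋-sum : ∀ m → m ≡ ⌊ m /2⌋ ℤ.+ ⌊ m ℤ.+ 1ℤ /2⌋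
⌊/2⌋-sum m with ⌊/2⌋-suc m
... | inj₁ (eq , eq′) = trans eq (trans (double ⌊ m /2⌋) (cong (ℤ._+_ ⌊ m /2⌋) (sym eq′)))
  where
  open ℤ-Solver
  double : ∀ h → h ℤ.* + 2 ≡ h ℤ.+ h
  double = solve 1 (λ h → h :* con (+ 2) := h :+ h) refl
... | inj₂ (eq , eq′) = trans eq (trans (double+1 ⌊ m /2⌋) (cong (ℤ._+_ ⌊ m /2⌋) (sym eq′)))
  where
  open ℤ-Solver
  double+1 : ∀ h → h ℤ.* + 2 ℤ.+ 1ℤ ≡ h ℤ.+ (h ℤ.+ 1ℤ)
  double+1 = solve 1 (λ h → h :* con (+ 2) :+ con 1ℤ := h :+ (h :+ con 1ℤ)) refl

-- Powers of -1, and B(M) as a sign matrix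

signPowℕ : ℕ → Sign
signPowℕ zero    = pos
signPowℕ (suc n) = opposite (signPowℕ n)

signPow : ℤ → Sign
signPow e = signPowℕ ℤ.∣ e ∣

⟦signPowℕ⟧ : ∀ n → ⟦ signPowℕ n ⟧ ≡ -1ℤ ℤ.^ n
⟦signPowℕ⟧ zero    = refl
⟦signPowℕ⟧ (suc n) with signPowℕ n | ⟦signPowℕ⟧ n
... | pos | eq = cong (-1ℤ ℤ.*_) eq
... | neg | eq = cong (-1ℤ ℤ.*_) eq

⟦signPow⟧ : ∀ e → ⟦ signPow e ⟧ ≡ [-1]^ e
⟦signPow⟧ e = ⟦signPowℕ⟧ ℤ.∣ e ∣

signPow-suc : ∀ e → signPow (e ℤ.+ 1ℤ) ≡ opposite (signPow e)
signPow-suc (+ n)        = cong signPowℕ (ℕₚ.+-comm n 1)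
signPow-suc -[1+ zero ]  = refl
signPow-suc -[1+ suc n ] = sym (Signₚ.opposite-involutive (opposite (signPowℕ n)))

signPow-pred : ∀ e → signPow (e ℤ.+ -1ℤ) ≡ opposite (signPow e)
signPow-pred e = Signₚ.opposite-injective (trans (sym (signPow-suc (e ℤ.+ -1ℤ)))
  (trans (cong signPow (trans (ℤₚ.+-assoc e -1ℤ 1ℤ) (ℤₚ.+-identityʳ e)))
         (sym (Signₚ.opposite-involutive (signPow e)))))

signPow-+ : ∀ x y → signPow (x ℤ.+ y) ≡ signPow x *ₛ signPow y
signPow-+ x (+ zero)  = trans (cong signPow (ℤₚ.+-identityʳ x)) (sym (Signₚ.*-identityʳ _))
signPow-+ x +[1+ n ]  = begin
  signPow (x ℤ.+ (1ℤ ℤ.+ + n))   ≡⟨ cong (λ y → signPow (x ℤ.+ y)) (ℤₚ.+-comm 1ℤ (+ n)) ⟩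
  signPow (x ℤ.+ (+ n ℤ.+ 1ℤ))   ≡⟨ cong signPow (ℤₚ.+-assoc x (+ n) 1ℤ) ⟨
  signPow (x ℤ.+ + n ℤ.+ 1ℤ)     ≡⟨ signPow-suc (x ℤ.+ + n) ⟩
  opposite (signPow (x ℤ.+ + n)) ≡⟨ cong opposite (signPow-+ x (+ n)) ⟩
  opposite (signPow x *ₛ signPow (+ n)) ≡⟨ opposite-*ʳ (signPow x) _ ⟨
  signPow x *ₛ signPow +[1+ n ]  ∎
  where open ≡-Reasoning
signPow-+ x -[1+ zero ] = trans (signPow-pred x)
  (trans (cong opposite (sym (Signₚ.*-identityʳ (signPow x)))) (sym (opposite-*ʳ (signPow x) pos)))
signPow-+ x -[1+ suc n ] = begin
  signPow (x ℤ.+ (-1ℤ ℤ.+ -[1+ n ]))   ≡⟨ cong (λ y → signPow (x ℤ.+ y)) (ℤₚ.+-comm -1ℤ -[1+ n ]) ⟩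
  signPow (x ℤ.+ (-[1+ n ] ℤ.+ -1ℤ))   ≡⟨ cong signPow (ℤₚ.+-assoc x -[1+ n ] -1ℤ) ⟨
  signPow (x ℤ.+ -[1+ n ] ℤ.+ -1ℤ)     ≡⟨ signPow-pred (x ℤ.+ -[1+ n ]) ⟩
  opposite (signPow (x ℤ.+ -[1+ n ]))  ≡⟨ cong opposite (signPow-+ x -[1+ n ]) ⟩
  opposite (signPow x *ₛ signPow -[1+ n ]) ≡⟨ opposite-*ʳ (signPow x) _ ⟨
  signPow x *ₛ signPow -[1+ suc n ]    ∎
  where open ≡-Reasoning

module _ {r : ℕ} where

  lowSign highSign : Vector ℤ r → Fin r → Sign
  lowSign  m i = signPow ⌊ m i /2⌋
  highSign m i = signPow ⌊ m i ℤ.+ 1ℤ /2⌋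

  Bᴹ≡signMatrix : ∀ m k l → Bᴹ m k l ≡ signMatrix (lowSign m) (highSign m) k l
  Bᴹ≡signMatrix m = blocks-cong {r}
    (λ i j → cong (ℤ._* δ (dist i j) 1) (cong₂ ℤ._*_ (high j) (cong₂ ℤ._-_ (low i) (low j))))
    (λ i j → cong (ℤ._* cartan i j) (power+1 ⌊ m i ℤ.+ 1ℤ /2⌋ ⌊ m j /2⌋))
    (λ i j → cong (ℤ._* cartan i j) (power ⌊ m i /2⌋ ⌊ m j ℤ.+ 1ℤ /2⌋))
    (λ i j → cong (ℤ._* δ (dist i j) 1) (cong₂ ℤ._*_ (low i) (cong₂ ℤ._-_ (high j) (high i))))
    where
    low : ∀ i → [-1]^ ⌊ m i /2⌋ ≡ ⟦ lowSign m i ⟧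
    low i = sym (⟦signPow⟧ ⌊ m i /2⌋)
    high : ∀ i → [-1]^ ⌊ m i ℤ.+ 1ℤ /2⌋ ≡ ⟦ highSign m i ⟧
    high i = sym (⟦signPow⟧ ⌊ m i ℤ.+ 1ℤ /2⌋)
    power : ∀ x y → [-1]^ (x ℤ.+ y) ≡ ⟦ signPow x *ₛ signPow y ⟧
    power x y = trans (sym (⟦signPow⟧ (x ℤ.+ y))) (cong ⟦_⟧ (signPow-+ x y))
    power+1 : ∀ x y → [-1]^ (x ℤ.+ y ℤ.+ 1ℤ) ≡ ⟦ opposite (signPow x *ₛ signPow y) ⟧
    power+1 x y = trans (sym (⟦signPow⟧ (x ℤ.+ y ℤ.+ 1ℤ)))
      (cong ⟦_⟧ (trans (signPow-suc (x ℤ.+ y)) (cong opposite (signPow-+ x y))))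

  B₀≡signMatrix : ∀ k l → B₀ r k l ≡ signMatrix (lowSign (λ _ → 0ℤ)) (highSign (λ _ → 0ℤ)) k l
  B₀≡signMatrix = blocks-cong {r}
    (λ i j → sym (ℤₚ.*-zeroˡ (δ (dist i j) 1)))
    (λ i j → sym (ℤₚ.-1*i≡-i (cartan i j)))
    (λ i j → sym (ℤₚ.*-identityˡ (cartan i j)))
    (λ i j → sym (ℤₚ.*-zeroˡ (δ (dist i j) 1)))

-- Neighbouring heights of Motzkin paths

∣-∣≡1⇒ : ∀ m n → ∣ m - n ∣ ≡ 1 → m ≡ suc n ⊎ n ≡ suc m
∣-∣≡1⇒ zero    (suc n) eq = inj₂ eq
∣-∣≡1⇒ (suc m) zero    eq = inj₁ eq
∣-∣≡1⇒ (suc m) (suc n) eq with ∣-∣≡1⇒ m n eq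
... | inj₁ m≡ = inj₁ (cong suc m≡)
... | inj₂ n≡ = inj₂ (cong suc n≡)

motzkin-near : ∀ {r} (m : Vector ℤ r) → IsMotzkin m →
               ∀ i j → dist i j ≡ 1 → ℤ.∣ m i ℤ.- m j ∣ ≤ 1
motzkin-near m motzkin i j eq with ∣-∣≡1⇒ (toℕ i) (toℕ j) eq
... | inj₁ i≡ = motzkin j i i≡
... | inj₂ j≡ = subst (_≤ 1) (ℤₚ.∣i-j∣≡∣j-i∣ (m j) (m i)) (motzkin i j j≡)

0-or-1 : ∀ x → ℤ.∣ x ∣ ≤ 1 → ℤ.∣ x ℤ.- 1ℤ ∣ ≤ 1 → x ≡ 0ℤ ⊎ x ≡ 1ℤ
0-or-1 (+ 0)           _        _ = inj₁ refl
0-or-1 (+ 1)           _        _ = inj₂ refl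
0-or-1 (+ suc (suc n)) (s≤s ()) _
0-or-1 -[1+ n ]        _        (s≤s ())

-- An integer within 1 of both 2h and 2h + 1 is one of the two. The two bounds will come from the
-- Motzkin conditions before and after a mutation.
⌊/2⌋-near-pair : ∀ h v → ℤ.∣ v ℤ.- h ℤ.* + 2 ∣ ≤ 1 →
                 ℤ.∣ v ℤ.- (h ℤ.* + 2 ℤ.+ 1ℤ) ∣ ≤ 1 → ⌊ v /2⌋ ≡ h
⌊/2⌋-near-pair h v close₀ close₁
  with 0-or-1 (v ℤ.- h ℤ.* + 2) close₀ (subst (λ z → ℤ.∣ z ∣ ≤ 1) (assoc v h) close₁)
  where
  open ℤ-Solver
  assoc : ∀ v h → v ℤ.- (h ℤ.* + 2 ℤ.+ 1ℤ) ≡ v ℤ.- h ℤ.* + 2 ℤ.- 1ℤ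
  assoc = solve 2 (λ v h → v :- (h :* con (+ 2) :+ con 1ℤ) := v :- h :* con (+ 2) :- con 1ℤ) refl
... | inj₁ eq = ⌊/2⌋-even h (ℤₚ.i-j≡0⇒i≡j v (h ℤ.* + 2) eq)
... | inj₂ eq = ⌊/2⌋-odd h (trans (restore v h) (cong (ℤ._+_ (h ℤ.* + 2)) eq))
  where
  open ℤ-Solver
  restore : ∀ v h → v ≡ h ℤ.* + 2 ℤ.+ (v ℤ.- h ℤ.* + 2)
  restore = solve 2 (λ v h → v := h :* con (+ 2) :+ (v :- h :* con (+ 2))) refl

-- Two distinct integers with equal halves are 2h and 2h + 1.
module _ {x y : ℤ} (half : ⌊ x /2⌋ ≡ ⌊ y /2⌋) (x≢y : x ≢ y) where

  ⌊/2⌋-near : ∀ v → ℤ.∣ v ℤ.- x ∣ ≤ 1 → ℤ.∣ v ℤ.- y ∣ ≤ 1 → ⌊ v /2⌋ ≡ ⌊ y /2⌋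
  ⌊/2⌋-near v close-x close-y with parity x | parity y
  ... | inj₁ (_ , ex) | inj₁ (_ , ey) =
    contradiction (trans ex (trans (cong (ℤ._* + 2) half) (sym ey))) x≢y
  ... | inj₂ (_ , ex) | inj₂ (_ , ey) =
    contradiction (trans ex (trans (cong (λ h → h ℤ.* + 2 ℤ.+ 1ℤ) half) (sym ey))) x≢y
  ... | inj₁ (_ , ex) | inj₂ (_ , ey) = ⌊/2⌋-near-pair ⌊ y /2⌋ v
    (subst (λ z → ℤ.∣ v ℤ.- z ∣ ≤ 1) (trans ex (cong (ℤ._* + 2) half)) close-x)
    (subst (λ z → ℤ.∣ v ℤ.- z ∣ ≤ 1) ey close-y)
  ... | inj₂ (_ , ex) | inj₁ (_ , ey) = ⌊/2⌋-near-pair ⌊ y /2⌋ v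
    (subst (λ z → ℤ.∣ v ℤ.- z ∣ ≤ 1) ey close-y)
    (subst (λ z → ℤ.∣ v ℤ.- z ∣ ≤ 1) (trans ex (cong (λ h → h ℤ.* + 2 ℤ.+ 1ℤ) half)) close-x)

  -- On 2h and 2h + 1 the half of the successor is h and h + 1 respectively, so the two exponents
  -- differ in parity.
  signPow-flip : signPow ⌊ x ℤ.+ 1ℤ /2⌋ ≡ opposite (signPow ⌊ y ℤ.+ 1ℤ /2⌋)
  signPow-flip with ⌊/2⌋-suc x | ⌊/2⌋-suc y
  ... | inj₁ (ex , _) | inj₁ (ey , _) =
    contradiction (trans ex (trans (cong (ℤ._* + 2) half) (sym ey))) x≢y
  ... | inj₂ (ex , _) | inj₂ (ey , _) =
    contradiction (trans ex (trans (cong (λ h → h ℤ.* + 2 ℤ.+ 1ℤ) half) (sym ey))) x≢y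
  ... | inj₁ (_ , sx) | inj₂ (_ , sy) rewrite sx | sy | half =
    sym (trans (cong opposite (signPow-suc ⌊ y /2⌋)) (Signₚ.opposite-involutive _))
  ... | inj₂ (_ , sx) | inj₁ (_ , sy) rewrite sx | sy | half = signPow-suc ⌊ y /2⌋

-- Induction along Q-system mutations

module _ {c ℓ₁ ℓ₂ : Level} (F : HeytingField c ℓ₁ ℓ₂) {r : ℕ} (Q : QSystem F r) where

  open Evaluation F using (_≈_; ≈-refl; ≈-sym; ≈-trans; ≈-reflexive)
  open QSystem Q
  open Seed

  R-evenOf-injective : ∀ (i : Fin r) m n → R (here i) (evenOf m) ≈ R (here i) (evenOf n) →
                       ⌊ m ℤ.+ 1ℤ /2⌋ ≡ ⌊ n ℤ.+ 1ℤ /2⌋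
  R-evenOf-injective i m n eq with R-injective F Q i (evenOf m) (evenOf n) eq
  ... | inj₁ even≡ =
    ℤₚ.*-cancelʳ-≡ _ _ (+ 2) (trans (sym (evenOf≡ m)) (trans even≡ (evenOf≡ n)))
  ... | inj₂ sum≡1 = contradiction
    (trans (ℤₚ.*-distribʳ-+ (+ 2) ⌊ m ℤ.+ 1ℤ /2⌋ ⌊ n ℤ.+ 1ℤ /2⌋)
      (trans (sym (cong₂ ℤ._+_ (evenOf≡ m) (evenOf≡ n))) sum≡1))
    (double≢1 (⌊ m ℤ.+ 1ℤ /2⌋ ℤ.+ ⌊ n ℤ.+ 1ℤ /2⌋))

  R-oddOf-injective : ∀ (i : Fin r) m n → R (here i) (oddOf m) ≈ R (here i) (oddOf n) →
                      ⌊ m /2⌋ ≡ ⌊ n /2⌋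
  R-oddOf-injective i m n eq with R-injective F Q i (oddOf m) (oddOf n) eq
  ... | inj₁ odd≡ =
    ℤₚ.*-cancelʳ-≡ _ _ (+ 2) (∙-cancelʳ 1ℤ _ _ (trans (sym (oddOf≡ m)) (trans odd≡ (oddOf≡ n))))
  ... | inj₂ sum≡1 = contradiction
    (trans (regroup ⌊ m /2⌋ ⌊ n /2⌋) (trans (sym (cong₂ ℤ._+_ (oddOf≡ m) (oddOf≡ n))) sum≡1))
    (double≢1 (⌊ m /2⌋ ℤ.+ ⌊ n /2⌋ ℤ.+ 1ℤ))
    where
    open ℤ-Solver
    regroup : ∀ h k → (h ℤ.+ k ℤ.+ 1ℤ) ℤ.* + 2 ≡ (h ℤ.* + 2 ℤ.+ 1ℤ) ℤ.+ (k ℤ.* + 2 ℤ.+ 1ℤ)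
    regroup = solve 2 (λ h k → (h :+ k :+ con 1ℤ) :* con (+ 2)
                := (h :* con (+ 2) :+ con 1ℤ) :+ (k :* con (+ 2) :+ con 1ℤ)) refl

  -- The indices differ by 2 and add up to 2n, which is never 1. Hence a Q-system mutation really
  -- changes the variable, and the height of the path at its label.
  R-step-distinct : ∀ (i : Fin r) n → ¬ (R (here i) (n ℤ.- 1ℤ) ≈ R (here i) (n ℤ.+ 1ℤ))
  R-step-distinct i n eq with R-injective F Q i (n ℤ.- 1ℤ) (n ℤ.+ 1ℤ) eq
  ... | inj₁ eq′ = contradiction (trans (sym (difference≡2 n)) (ℤₚ.i≡j⇒i-j≡0 (sym eq′))) λ ()
    where
    open ℤ-Solver
    difference≡2 : ∀ n → (n ℤ.+ 1ℤ) ℤ.- (n ℤ.- 1ℤ) ≡ + 2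
    difference≡2 = solve 1 (λ n → (n :+ con 1ℤ) :- (n :- con 1ℤ) := con (+ 2)) refl
  ... | inj₂ eq′ = double≢1 n (trans (regroup n) eq′)
    where
    open ℤ-Solver
    regroup : ∀ n → n ℤ.* + 2 ≡ n ℤ.- 1ℤ ℤ.+ (n ℤ.+ 1ℤ)
    regroup = solve 1 (λ n → n :* con (+ 2) := n :- con 1ℤ :+ (n :+ con 1ℤ)) refl

  xᴹ-even : ∀ m i → xᴹ F Q m (i ↑ˡ r) ≡ R (here i) (evenOf (m i))
  xᴹ-even m = Vectorₚ.lookup-++ˡ (λ α → R (here α) (evenOf (m α))) (λ α → R (here α) (oddOf (m α)))

  xᴹ-odd : ∀ m i → xᴹ F Q m (r ↑ʳ i) ≡ R (here i) (oddOf (m i))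
  xᴹ-odd m = Vectorₚ.lookup-++ʳ (λ α → R (here α) (evenOf (m α))) (λ α → R (here α) (oddOf (m α)))

  xᴹ-injective-even : ∀ m m′ i → xᴹ F Q m (i ↑ˡ r) ≈ xᴹ F Q m′ (i ↑ˡ r) →
                      ⌊ m i ℤ.+ 1ℤ /2⌋ ≡ ⌊ m′ i ℤ.+ 1ℤ /2⌋
  xᴹ-injective-even m m′ i eq = R-evenOf-injective i (m i) (m′ i)
    (subst₂ _≈_ (xᴹ-even m i) (xᴹ-even m′ i) eq)

  xᴹ-injective-odd : ∀ m m′ i → xᴹ F Q m (r ↑ʳ i) ≈ xᴹ F Q m′ (r ↑ʳ i) → ⌊ m i /2⌋ ≡ ⌊ m′ i /2⌋
  xᴹ-injective-odd m m′ i eq = R-oddOf-injective i (m i) (m′ i)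
    (subst₂ _≈_ (xᴹ-odd m i) (xᴹ-odd m′ i) eq)

  -- The invariant of the induction. A step compares the old path with the new one and uses the
  -- Motzkin condition of both, so the path travels with the seed.
  record IsMotzkinSeed (s : Seed F (r + r)) (m : Vector ℤ r) : Set ℓ₁ where
    field
      motzkin    : IsMotzkin m
      hasCluster : HasCluster F Q s m
      matrix≡    : ∀ k l → matrix s k l ≡ signMatrix (lowSign m) (highSign m) k l

  module _ {s : Seed F (r + r)} {M m : Vector ℤ r} {k : Fin (r + r)}
           (xₖ#0 : HeytingField._#_ F (cluster s k) (HeytingField.0# F))
           (s-Motzkin : IsMotzkinSeed s M)
           (motzkin′ : IsMotzkin m) (hasCluster′ : HasCluster F Q (mutate F k s xₖ#0) m)
           where

    open IsMotzkinSeed s-Motzkin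

    xᴹ-off : ∀ {l} → l ≢ k → xᴹ F Q m l ≈ xᴹ F Q M l
    xᴹ-off {l} l≢k =
      ≈-trans (≈-sym (hasCluster′ l)) (≈-trans (≈-reflexive unchanged) (hasCluster l))
      where
      unchanged : cluster (mutate F k s xₖ#0) l ≡ cluster s l
      unchanged rewrite dec-false (l Finₚ.≟ k) l≢k = refl

    xᴹ-changed : IsQMutation F Q k s (mutate F k s xₖ#0) → ¬ (xᴹ F Q m k ≈ xᴹ F Q M k)
    xᴹ-changed (α , n , _ , inj₁ (old , new)) eq = R-step-distinct α n
      (≈-trans (≈-sym old) (≈-trans (hasCluster k)
        (≈-trans (≈-sym eq) (≈-trans (≈-sym (hasCluster′ k)) new))))
    xᴹ-changed (α , n , _ , inj₂ (old , new)) eq = R-step-distinct α n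
      (≈-trans (≈-sym new) (≈-trans (hasCluster′ k)
        (≈-trans eq (≈-trans (≈-sym (hasCluster k)) old))))

    same-halves : ∀ β → ⌊ m β /2⌋ ≡ ⌊ M β /2⌋ → ⌊ m β ℤ.+ 1ℤ /2⌋ ≡ ⌊ M β ℤ.+ 1ℤ /2⌋ → m β ≡ M β
    same-halves β lo hi = trans (⌊/2⌋-sum (m β)) (trans (cong₂ ℤ._+_ lo hi) (sym (⌊/2⌋-sum (M β))))

    mutate-even-Motzkin : ∀ α → k ≡ α ↑ˡ r → m α ≢ M α → IsMotzkinSeed (mutate F k s xₖ#0) m
    mutate-even-Motzkin α refl mα≢Mα = record
      { motzkin    = motzkin′
      ; hasCluster = hasCluster′
      ; matrix≡    = λ l l′ → trans (mutateMatrix-cong k matrix≡ l l′) (trans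
          (signMatrix-mutate-even α (lowSign M) (highSign M) (highSign m) near
            (signPow-flip (lo α) mα≢Mα) (λ β≢α → cong signPow (hi β≢α)) l l′)
          (signMatrix-cong (λ i → cong signPow (sym (lo i))) (λ _ → refl) l l′))
      }
      where
      lo : ∀ β → ⌊ m β /2⌋ ≡ ⌊ M β /2⌋
      lo β = xᴹ-injective-odd m M β (xᴹ-off (↑ʳ≢↑ˡ β α))
      hi : ∀ {β} → β ≢ α → ⌊ m β ℤ.+ 1ℤ /2⌋ ≡ ⌊ M β ℤ.+ 1ℤ /2⌋
      hi {β} β≢α = xᴹ-injective-even m M β (xᴹ-off (β≢α ∘ Finₚ.↑ˡ-injective r β α))
      near : ∀ β → dist β α ≡ 1 → lowSign M β ≡ lowSign M α
      -- The height at β is the same in both paths, hence within 1 of both the new and the old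
      -- height at α.
      near β eq = cong signPow (⌊/2⌋-near (lo α) mα≢Mα (M β)
        (subst (λ z → ℤ.∣ z ℤ.- m α ∣ ≤ 1) (same-halves β (lo β) (hi (dist-≡1⇒≢ eq)))
          (motzkin-near m motzkin′ β α eq))
        (motzkin-near M motzkin β α eq))

    -- The even case applied to heights shifted by 1: now ⌊(m+1)/2⌋ is what stays, and ⌊(m+2)/2⌋ =
    -- ⌊m/2⌋ + 1 translates the flip back to `lowSign`.
    mutate-odd-Motzkin : ∀ α → k ≡ r ↑ʳ α → m α ≢ M α → IsMotzkinSeed (mutate F k s xₖ#0) m
    mutate-odd-Motzkin α refl mα≢Mα = record
      { motzkin    = motzkin′
      ; hasCluster = hasCluster′
      ; matrix≡    = λ l l′ → trans (mutateMatrix-cong k matrix≡ l l′) (trans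
          (signMatrix-mutate-odd α (lowSign M) (highSign M) (lowSign m) near
            flip (λ β≢α → cong signPow (lo β≢α)) l l′)
          (signMatrix-cong (λ _ → refl) (λ i → cong signPow (sym (hi i))) l l′))
      }
      where
      lo : ∀ {β} → β ≢ α → ⌊ m β /2⌋ ≡ ⌊ M β /2⌋
      lo {β} β≢α = xᴹ-injective-odd m M β (xᴹ-off (β≢α ∘ Finₚ.↑ʳ-injective r β α))
      hi : ∀ β → ⌊ m β ℤ.+ 1ℤ /2⌋ ≡ ⌊ M β ℤ.+ 1ℤ /2⌋
      hi β = xᴹ-injective-even m M β (xᴹ-off (↑ʳ≢↑ˡ α β ∘ sym))
      m+1≢M+1 : m α ℤ.+ 1ℤ ≢ M α ℤ.+ 1ℤ
      m+1≢M+1 = mα≢Mα ∘ ∙-cancelʳ 1ℤ _ _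
      flip : lowSign m α ≡ opposite (lowSign M α)
      flip = Signₚ.opposite-injective (begin
        opposite (lowSign m α)               ≡⟨ signPow-suc ⌊ m α /2⌋ ⟨
        signPow (⌊ m α /2⌋ ℤ.+ 1ℤ)           ≡⟨ cong signPow (⌊/2⌋-+2 (m α)) ⟨
        signPow ⌊ m α ℤ.+ 1ℤ ℤ.+ 1ℤ /2⌋      ≡⟨ signPow-flip (hi α) m+1≢M+1 ⟩
        opposite (signPow ⌊ M α ℤ.+ 1ℤ ℤ.+ 1ℤ /2⌋)  ≡⟨ cong (opposite ∘ signPow) (⌊/2⌋-+2 (M α)) ⟩
        opposite (signPow (⌊ M α /2⌋ ℤ.+ 1ℤ))  ≡⟨ cong opposite (signPow-suc ⌊ M α /2⌋) ⟩
        opposite (opposite (lowSign M α))    ∎)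
        where open ≡-Reasoning
      shift : ∀ x y → ℤ.∣ x ℤ.- y ∣ ≤ 1 → ℤ.∣ (x ℤ.+ 1ℤ) ℤ.- (y ℤ.+ 1ℤ) ∣ ≤ 1
      shift x y = subst (λ z → ℤ.∣ z ∣ ≤ 1) (cancel x y)
        where
        open ℤ-Solver
        cancel : ∀ x y → x ℤ.- y ≡ (x ℤ.+ 1ℤ) ℤ.- (y ℤ.+ 1ℤ)
        cancel = solve 2 (λ x y → x :- y := (x :+ con 1ℤ) :- (y :+ con 1ℤ)) refl
      near : ∀ β → dist β α ≡ 1 → highSign M β ≡ highSign M α
      near β eq = cong signPow (⌊/2⌋-near (hi α) m+1≢M+1 (M β ℤ.+ 1ℤ)
        (subst (λ z → ℤ.∣ (z ℤ.+ 1ℤ) ℤ.- (m α ℤ.+ 1ℤ) ∣ ≤ 1)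
          (same-halves β (lo (dist-≡1⇒≢ eq)) (hi β))
          (shift (m β) (m α) (motzkin-near m motzkin′ β α eq)))
        (shift (M β) (M α) (motzkin-near M motzkin β α eq)))

    mutate-Motzkin : IsQMutation F Q k s (mutate F k s xₖ#0) → IsMotzkinSeed (mutate F k s xₖ#0) m
    mutate-Motzkin q@(α , _ , inj₁ k≡ , _) = mutate-even-Motzkin α k≡ λ mα≡Mα → xᴹ-changed q
      (≈-reflexive (subst (λ l → xᴹ F Q m l ≡ xᴹ F Q M l) (sym k≡)
        (trans (xᴹ-even m α) (trans (cong (R (here α) ∘ evenOf) mα≡Mα) (sym (xᴹ-even M α))))))
    mutate-Motzkin q@(α , _ , inj₂ k≡ , _) = mutate-odd-Motzkin α k≡ λ mα≡Mα → xᴹ-changed q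
      (≈-reflexive (subst (λ l → xᴹ F Q m l ≡ xᴹ F Q M l) (sym k≡)
        (trans (xᴹ-odd m α) (trans (cong (R (here α) ∘ oddOf) mα≡Mα) (sym (xᴹ-odd M α))))))

  Reachable⇒Motzkin : ∀ {s} → Reachable F Q s → ∃[ m ] IsMotzkinSeed s m
  -- `evenOf 0ℤ` and `oddOf 0ℤ` compute to 0 and 1, so the initial cluster is by definition that of
  -- the zero path.
  Reachable⇒Motzkin start = (λ _ → 0ℤ) , record
    { motzkin    = λ _ _ _ → z≤n
    ; hasCluster = λ _ → ≈-refl
    ; matrix≡    = B₀≡signMatrix {r}
    }
  Reachable⇒Motzkin (step reach k xₖ#0 q m motzkin′ hasCluster′) =
    m , mutate-Motzkin xₖ#0 (proj₂ (Reachable⇒Motzkin reach)) motzkin′ hasCluster′ q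

mainTheorem12 : ∀ {c ℓ₁ ℓ₂ : Level} (F : HeytingField c ℓ₁ ℓ₂)
    (r : ℕ) → 1 ≤ r → (Q : QSystem F r)
    (m : Vector ℤ r) → IsMotzkin m →
    (s : Seed F (r + r)) → Reachable F Q s → HasCluster F Q s m →
    (a b : Fin (r + r)) → Seed.matrix s a b ≡ Bᴹ m a b
mainTheorem12 F r _ Q m _ s reach hasClusterₘ a b with Reachable⇒Motzkin F Q reach
-- The path M of the induction and the given m share a cluster; only their signs have to be
-- compared.
... | M , s-Motzkin = trans (matrix≡ a b) (trans
    (signMatrix-cong
      (λ i → cong signPow (xᴹ-injective-odd F Q M m i (same (r ↑ʳ i))))
      (λ i → cong signPow (xᴹ-injective-even F Q M m i (same (i ↑ˡ r)))) a b)
    (sym (Bᴹ≡signMatrix m a b)))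
  where
  open Evaluation F using (_≈_; ≈-sym; ≈-trans)
  open IsMotzkinSeed s-Motzkin
  same : ∀ k → xᴹ F Q M k ≈ xᴹ F Q m k
  same k = ≈-trans (≈-sym (hasCluster k)) (hasClusterₘ k)
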